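{- For any skew shape $S$, the number of binary fillings of $S$ that avoid $\delta_2$ is the same as the number of binary fillings of $S$ that avoid both $\iota_2$ and $\phi_{\mathrm{D}}$. Moreover, there is a bijection between these two sets of fillings that preserves the number of 1-cells in every row.
   Context: A cell is a unit square with vertices in $\mathbb{Z}^2$; its coordinates are those of its top-right corner, so cell $(i,j)$ is the cell in column $i$ and row $j$ (columns numbered left to right, rows numbered bottom to top). A shape is a finite union of cells; shapes are considered up to translation and, unless stated otherwise, a nonempty shape is placed so that its leftmost cell has column coordinate $1$ and its bottommost cell has row coordinate $1$. The height (width) of a shape is the row coordinate of its topmost cell (the column coordinate of its rightmost cell). A NW Ferrers shape is a top-left justified Young-diagram shape: every row is a contiguous run of cells, every column is a contiguous run of cells, all rows have their leftmost cell in the same column, and all columns have their topmost cell in the same row. A skew shape is a shape of the form $S=F_1\setminus F_2$ (the cells of $F_1$ not belonging to $F_2$), where $F_1$ and $F_2$ are NW Ferrers shapes with the same top-left cell ($F_2$ may be empty). Containment of shapes: a shape $S$ of height $h$ and width $w$ contains a shape $T$ of height $k$ and width $\ell$ if there are row indices $1\le r_1<\dots<r_k\le h$ and column indices $1\le c_1<\dots<c_\ell\le w$ such that for all $1\le i\le \ell$, $1\le j\le k$, the cell $(i,j)$ belongs to $T$ if and only if the cell $(c_i,r_j)$ belongs to $S$. Such rows and columns form an occurrence of $T$ in $S$. A binary filling of a shape is a function assigning a value in $\{0,1\}$ to each cell; a 1-cell is a cell with value $1$. A filling $\phi_S$ of $S$ contains a filling $\phi_T$ of $T$ if there is an occurrence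 of $T$ in $S$, in rows $r_1<\dots<r_k$ and columns $c_1<\dots<c_\ell$, such that $\phi_T(i,j)\le\phi_S(c_i,r_j)$ for every cell $(i,j)$ of $T$; otherwise $\phi_S$ avoids $\phi_T$. $\iota_2$ is the filling of the $2\times2$ square shape with 1-cells $(1,1),(2,2)$, and $\delta_2$ is the filling of the $2\times 2$ square shape with 1-cells $(1,2),(2,1)$ (other cells have value $0$). $\mathrm{D}$ is the skew shape obtained from the $3\times3$ square $\{(i,j):1\le i,j\le 3\}$ by removing the top-left cell $(1,3)$ and the bottom-right cell $(3,1)$, and $\phi_{\mathrm{D}}$ is the binary filling of $\mathrm{D}$ whose 1-cells are exactly $(1,1)$, $(2,3)$, $(3,2)$. -}

module Defs where

open import Data.Bool.Base using (Bool; true; false; T)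
import Data.Bool.Base as Bool
open import Data.Fin.Base using (Fin; toℕ)
import Data.Fin.Base as Fin
open import Data.Fin.Patterns using (0F; 1F; 2F)
open import Data.Fin.Subset using (∣_∣)
open import Data.Integer.Base using (ℤ; +_)
import Data.Integer.Base as ℤ
open import Data.List.Base using (List; [])
open import Data.List.Membership.Propositional using (_∈_)
open import Data.Nat.Base using (ℕ; suc)
open import Data.Product.Base using (Σ; ∃; ∃₂; _×_; _,_; proj₁; proj₂)
open import Data.Sum.Base using (_⊎_)
open import Data.Unit.Base using (tt)
open import Data.Vec.Base using (tabulate)
open import Function.Bundles using (Inverse; Bijection)
open import Level using (0ℓ)
open import Relation.Binary.Bundles using (Setoid)
open import Relation.Binary.Definitions using (Monotonic₁)
import Relation.Binary.Construct.On as On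
open import Relation.Binary.PropositionalEquality using (_≡_; refl; sym; trans; subst)
import Relation.Binary.PropositionalEquality as ≡
open import Relation.Nullary using (¬_; yes; no)
open import Relation.Nullary.Decidable using (T?)
open import Relation.Unary using (Pred; _≐_; _∖_)

-- (column , row): columns increase to the right, rows increase upwards.
Cell : Set
Cell = ℤ × ℤ

-- A shape in its normalised position, as the indicator function of its
-- bounding box.  Arguments are column, then row; they are 0-based, so
-- `has i j` concerns the cell (toℕ i + 1 , toℕ j + 1).  The four conditions
-- say that the box is tight; the empty shape is the one with a 0 × 0 box.
record Shape : Set where
  field
    width height : ℕ
    has          : Fin width → Fin height → Bool
    leftmost     : ∀ i → toℕ i ≡ 0            → ∃ λ j → T (has i j)
    rightmost    : ∀ i → suc (toℕ i) ≡ width  → ∃ λ j → T (has i j)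
    bottommost   : ∀ j → toℕ j ≡ 0            → ∃ λ i → T (has i j)
    topmost      : ∀ j → suc (toℕ j) ≡ height → ∃ λ i → T (has i j)

open Shape public

cells : Shape → Pred Cell 0ℓ
cells S c = ∃₂ λ i j → T (has S i j) × c ≡ (+ suc (toℕ i) , + suc (toℕ j))

-- A finite set of cells in arbitrary position, used for the Ferrers shapes
-- F₁ and F₂, which may stick out of the bounding box of F₁ ∖ F₂.
Region : Set
Region = List Cell

record NWFerrers (topLeft : Cell) (F : Region) : Set where
  private
    i₀ = proj₁ topLeft
    j₀ = proj₂ topLeft
  field
    topLeft∈F      : topLeft ∈ F
    rowsContiguous : ∀ {i i′ i″ j} → (i , j) ∈ F → (i″ , j) ∈ F →
                     i ℤ.≤ i′ → i′ ℤ.≤ i″ → (i′ , j) ∈ F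
    colsContiguous : ∀ {i j j′ j″} → (i , j) ∈ F → (i , j″) ∈ F →
                     j ℤ.≤ j′ → j′ ℤ.≤ j″ → (i , j′) ∈ F
    leftJustified  : ∀ {i j} → (i , j) ∈ F → (i₀ , j) ∈ F × i₀ ℤ.≤ i
    topJustified   : ∀ {i j} → (i , j) ∈ F → (i , j₀) ∈ F × j ℤ.≤ j₀

-- Translates of NW Ferrers shapes are NW Ferrers shapes, so letting topLeft
-- vary accounts for the translation that puts F₁ ∖ F₂ in normalised position.
record IsSkew (S : Shape) : Set where
  field
    topLeft    : Cell
    F₁ F₂      : Region
    F₁-ferrers : NWFerrers topLeft F₁
    F₂-ferrers : F₂ ≡ [] ⊎ NWFerrers topLeft F₂
    difference : cells S ≐ ((_∈ F₁) ∖ (_∈ F₂))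

record Occurrence (P S : Shape) : Set where
  field
    row            : Fin (height P) → Fin (height S)
    col            : Fin (width P) → Fin (width S)
    row-increasing : Monotonic₁ Fin._<_ Fin._<_ row
    col-increasing : Monotonic₁ Fin._<_ Fin._<_ col
    matches        : ∀ i j → has P i j ≡ has S (col i) (row j)

-- The proof that a cell belongs to the shape is irrelevant, so that a filling
-- takes one value per cell.
Filling : Shape → Set
Filling S = ∀ i j → .(T (has S i j)) → Bool

fillingSetoid : Shape → Setoid 0ℓ 0ℓ
fillingSetoid S = record
  { Carrier       = Filling S
  ; _≈_           = λ φ ψ → ∀ i j .(c : T (has S i j)) → φ i j c ≡ ψ i j c
  ; isEquivalence = record
    { refl  = λ i j c → refl
    ; sym   = λ p i j c → sym (p i j c)
    ; trans = λ p q i j c → trans (p i j c) (q i j c)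
    }
  }

module _ {S P : Shape} where

  Contains : Filling S → Filling P → Set
  Contains φ π = Σ (Occurrence P S) λ o → let open Occurrence o in
    ∀ i j (c : T (has P i j)) →
    π i j c Bool.≤ φ (col i) (row j) (subst T (matches i j) c)

  Avoids : Filling S → Filling P → Set
  Avoids φ π = ¬ Contains φ π

-- The fillings of S satisfying A, compared as fillings.
fillingsWith : (S : Shape) → Pred (Filling S) 0ℓ → Setoid 0ℓ 0ℓ
fillingsWith S A = On.setoid {B = Σ (Filling S) A} (fillingSetoid S) proj₁

HasSize : Setoid 0ℓ 0ℓ → ℕ → Set
HasSize A n = Inverse (≡.setoid (Fin n)) A

isOneCell : ∀ {S} → Filling S → Fin (width S) → Fin (height S) → Bool
isOneCell {S} φ i j with T? (has S i j)
... | yes c = φ i j c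
... | no  _ = false

rowOnes : ∀ {S} → Filling S → Fin (height S) → ℕ
rowOnes {S} φ j = ∣ tabulate (λ i → isOneCell {S} φ i j) ∣

□₂ : Shape
□₂ = record
  { width      = 2
  ; height     = 2
  ; has        = λ _ _ → true
  ; leftmost   = λ _ _ → 0F , tt
  ; rightmost  = λ _ _ → 0F , tt
  ; bottommost = λ _ _ → 0F , tt
  ; topmost    = λ _ _ → 0F , tt
  }

ι₂ : Filling □₂
ι₂ 0F 0F _ = true
ι₂ 1F 1F _ = true
ι₂ _  _  _ = false

δ₂ : Filling □₂
δ₂ 0F 1F _ = true
δ₂ 1F 0F _ = true
δ₂ _  _  _ = false

hasD : Fin 3 → Fin 3 → Bool
hasD 0F 2F = false
hasD 2F 0F = false
hasD _  _  = true

D : Shape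
D = record
  { width      = 3
  ; height     = 3
  ; has        = hasD
  ; leftmost   = λ { 0F _ → 0F , tt }
  ; rightmost  = λ { 2F _ → 2F , tt }
  ; bottommost = λ { 0F _ → 0F , tt }
  ; topmost    = λ { 2F _ → 2F , tt }
  }

φD : Filling D
φD 0F 0F _ = true
φD 1F 2F _ = true
φD 2F 1F _ = true
φD _  _  _ = false

Avoidδ₂ : Shape → Setoid 0ℓ 0ℓ
Avoidδ₂ S = fillingsWith S λ φ → Avoids {S} {□₂} φ δ₂

Avoidι₂φD : Shape → Setoid 0ℓ 0ℓ
Avoidι₂φD S = fillingsWith S λ φ → Avoids {S} {□₂} φ ι₂ × Avoids {S} {D} φ φD

PreservesRowOnes : ∀ S → Bijection (Avoidδ₂ S) (Avoidι₂φD S) → Set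
PreservesRowOnes S f = ∀ φ j →
  rowOnes {S} (proj₁ (Bijection.to f φ)) j ≡ rowOnes {S} (proj₁ φ) j

{-# OPTIONS --safe #-}
module Submission where

-- Fill the rows from top to bottom. A filling avoids δ₂ iff every 1-cell lies weakly to the left
-- of all 1-cells in higher rows, so the number of columns of the next row that are still allowed
-- is a complete state. A filling avoids ι₂ and φD iff for every 1-cell c either no higher row
-- meeting the column of c has a 1-cell to the right of c, or no column to the right of c meeting
-- the row of c has a 1-cell above c. Here the allowed columns depend on a word with one letter
-- per column of the current row, recording whether the column is occupied and whether its higher
-- rows are clear to the right. The number of completions of a word, for prescribed row sums, is
-- not determined by its number of allowed columns; but it satisfies a few linear relations
-- between words (Invariant below), which survive adding a row, adding columns on the left and
-- dropping columns on the right. They imply that the completions of ◇ᵏ●ʲ⁺¹ obey the recursion of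
-- the δ₂ case with k + 1 allowed and j forbidden columns. Thus the two classes have equally many
-- fillings for each vector of row sums.

open import Defs
open import Data.Bool.Base as Bool using (Bool; true; false; T; b≤b; if_then_else_; _∧_; _∨_; not)
open import Data.Bool.Properties as Boolₚ
  using (T-≡; ≤-minimum; ¬-not; ∧-conicalˡ; ∧-conicalʳ; ∧-identityʳ; ∧-zeroʳ; ∨-zeroʳ)
open import Data.Fin.Base as Fin using (Fin; zero; suc; toℕ; opposite)
open import Data.Fin.Patterns using (0F; 1F; 2F)
open import Data.Fin.Properties as Finₚ using (toℕ<n; toℕ-injective; any?; opposite-prop; opposite-involutive)
open import Data.Fin.Subset using (∣_∣)
open import Data.Integer.Base as ℤ using (+≤+)
import Data.Integer.Properties as ℤₚ
open import Data.List.Base as List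
  using (List; []; _∷_; _++_; replicate; take; drop; map; length; filterᵇ; cartesianProductWith)
open import Data.List.Membership.Propositional using (_∈_)
open import Data.List.Membership.Propositional.Properties
  using (∈-cartesianProductWith⁺; ∈-filter⁺; ∈-filter⁻; ∈-lookup; ∈-∃++)
open import Data.List.Properties using (map-++; map-cong; map-∘; ∷-injectiveʳ)
import Data.List.Relation.Binary.Permutation.Setoid as Permutation
import Data.List.Relation.Binary.Permutation.Setoid.Properties as Permutationₚ
open import Data.List.Relation.Unary.All as All using ([]; _∷_)
open import Data.List.Relation.Unary.AllPairs using ([]; _∷_)
open import Data.List.Relation.Unary.Any using (here; there; index)
open import Data.List.Relation.Unary.Any.Properties using (lookup-index)
open import Data.List.Relation.Unary.Unique.Propositional using (Unique)
open import Data.List.Relation.Unary.Unique.Propositional.Properties using (cartesianProductWith⁺; filter⁺)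
open import Data.Nat.Base
  using (ℕ; zero; suc; pred; _+_; _*_; _∸_; _⊓_; _⊔_; _≤_; _<_; z≤n; s≤s; _≡ᵇ_; _<ᵇ_)
open import Data.Nat.Combinatorics using (_C_; nCk+nC[k+1]≡[n+1]C[k+1])
open import Data.Nat.ListAction using (sum)
open import Data.Nat.ListAction.Properties using (sum-++)
open import Data.Nat.Properties as ℕₚ
open import Data.Nat.Tactic.RingSolver using (solve-∀)
open import Data.Product.Base using (Σ; ∃; ∃₂; _×_; _,_; proj₁; proj₂)
open import Data.Sum.Base using (_⊎_; inj₁; inj₂; map₂; [_,_]′)
open import Data.Unit.Base using (tt)
open import Data.Vec.Base as Vec using (Vec; []; _∷_; lookup; tabulate; toList)
open import Data.Vec.Properties
  using (≡-dec; ∷-injective; lookup∘tabulate; tabulate∘lookup; tabulate-cong; lookup-map; lookup-replicate)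
open import Function.Base using (_∘_)
open import Function.Bundles using (Inverse; Bijection; Equivalence)
import Function.Construct.Composition as Composition
import Function.Construct.Symmetry as Symmetry
open import Function.Properties.Inverse using (Inverse⇒Bijection)
open import Level using (0ℓ)
import Relation.Binary.Construct.On as On
open import Relation.Binary.Definitions using (DecidableEquality)
open import Relation.Binary.PropositionalEquality as ≡
  using (_≡_; refl; sym; trans; cong; cong₂; subst)
open import Relation.Nullary using (¬_; does; yes; no; contradiction)
open import Relation.Nullary.Decidable using (T?; ¬?; _×-dec_; dec-true)
open import Relation.Nullary.Negation using (contradiction-irr)
open import Relation.Unary using (Pred; Decidable)

-- Words and their completions

χ : Bool → ℕ → ℕ
χ b n = if b then n else 0

χ-+ : ∀ b m n → χ b (m + n) ≡ χ b m + χ b n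
χ-+ true  m n = refl
χ-+ false m n = refl

-- ● and ◆ are occupied columns; ◇ and ◆ are columns none of whose cells in the earlier (higher) rows
-- has a 1-cell to its right.
data Letter : Set where
  ○ ◇ ● ◆ : Letter

occupied rowClear : Letter → Bool
occupied ○ = false
occupied ◇ = false
occupied ● = true
occupied ◆ = true
rowClear ○ = false
rowClear ◇ = true
rowClear ● = false
rowClear ◆ = true

kill mark : Letter → Letter
kill ○ = ○
kill ◇ = ○
kill ● = ●
kill ◆ = ●
mark ○ = ●
mark ◇ = ◆
mark ● = ●
mark ◆ = ◆

Word : Set
Word = List Letter

vacant : Word → Bool
vacant []      = true
vacant (c ∷ w) = not (occupied c) ∧ vacant w

-- The two ways in which a new 1-cell in a column with letter `c` can be harmless; `w` is the rest
-- of the row to its right, read before the new row is filled.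
free : Letter → Word → Bool
free c w = rowClear c ∨ vacant w

-- choices n sums over the rows with n + 1 ones, not n: only the letters to the left of the last one
-- are killed, so the empty row behaves differently.
choices pick : ℕ → (Word → ℕ) → Word → ℕ
choices n φ []      = 0
choices n φ (c ∷ w) = choices n (φ ∘ (kill c ∷_)) w + χ (free c w) (pick n φ (c ∷ w))
pick n       φ []      = 0
pick zero    φ (c ∷ w) = φ (mark c ∷ w)
pick (suc n) φ (c ∷ w) = choices n (φ ∘ (● ∷_)) w

-- In `run k (suc j)` exactly k + 1 letters are free: every ◇, and the last ● because nothing stands
-- to its right. So this word plays the role of k + 1 allowed and j forbidden columns.
run : ℕ → ℕ → Word
run i m = replicate i ◇ ++ replicate m ●

-- For completion counts: a letter before vacant columns is free whatever its flag (`tail`);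
-- occupation of a column restricts only letters to its left and the clear flag only the column
-- itself, so the two effects add up (`exchange`); after `α`, the two words in `rotate` have equal
-- length and both have i + 2 free letters.
record Invariant (φ : Word → ℕ) : Set where
  field
    tail     : ∀ α c β → vacant β ≡ true → φ (α ++ c ∷ β) ≡ φ (α ++ kill c ∷ β)
    exchange : ∀ α β → φ (α ++ ◆ ∷ β) + φ (α ++ ○ ∷ β) ≡ φ (α ++ ● ∷ β) + φ (α ++ ◇ ∷ β)
    rotate   : ∀ α i m → φ (α ++ ● ∷ run (suc i) m) ≡ φ (α ++ ◆ ∷ run i (suc m))

open Invariant

cons : ∀ {φ} → Invariant φ → ∀ c → Invariant (φ ∘ (c ∷_))
cons inv c .tail α     = inv .tail (c ∷ α)
cons inv c .exchange α = inv .exchange (c ∷ α)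
cons inv c .rotate α   = inv .rotate (c ∷ α)

-- Adding a row preserves the invariant

kill-kill : ∀ c → kill (kill c) ≡ kill c
kill-kill ○ = refl
kill-kill ◇ = refl
kill-kill ● = refl
kill-kill ◆ = refl

mark-kill : ∀ c → mark (kill c) ≡ kill (mark c)
mark-kill ○ = refl
mark-kill ◇ = refl
mark-kill ● = refl
mark-kill ◆ = refl

occupied-kill : ∀ c → occupied (kill c) ≡ occupied c
occupied-kill ○ = refl
occupied-kill ◇ = refl
occupied-kill ● = refl
occupied-kill ◆ = refl

vacant-kill : ∀ α c β → vacant (α ++ c ∷ β) ≡ vacant (α ++ kill c ∷ β)
vacant-kill []      c β = cong (λ b → not b ∧ vacant β) (sym (occupied-kill c))
vacant-kill (d ∷ α) c β = cong (not (occupied d) ∧_) (vacant-kill α c β)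

vacant-++ : ∀ α β → vacant β ≡ false → vacant (α ++ β) ≡ false
vacant-++ []      β p = p
vacant-++ (d ∷ α) β p = trans (cong (not (occupied d) ∧_) (vacant-++ α β p)) (∧-zeroʳ (not (occupied d)))

free-occupied : ∀ d α c β → vacant β ≡ false → free d (α ++ c ∷ β) ≡ rowClear d ∨ false
free-occupied d α c β p = cong (rowClear d ∨_) (vacant-++ α (c ∷ β) (trans (cong (not (occupied c) ∧_) p) (∧-zeroʳ _)))

-- With `β` vacant both versions of the letter are free. If it or a letter left of it is the last
-- choice, `β` is unchanged and `inv .tail` applies; if a later letter is chosen, the flag is lost
-- on both sides.
choices-tail : ∀ n {φ} → Invariant φ → ∀ α c β → vacant β ≡ true →
               choices n φ (α ++ c ∷ β) ≡ choices n φ (α ++ kill c ∷ β)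
pick-tail : ∀ n {φ} → Invariant φ → ∀ α c β → vacant β ≡ true →
            pick n φ (α ++ c ∷ β) ≡ pick n φ (α ++ kill c ∷ β)
choices-tail n {φ} inv [] c β p
  rewrite kill-kill c | p | ∨-zeroʳ (rowClear c) | ∨-zeroʳ (rowClear (kill c))
  = cong (choices n (φ ∘ (kill c ∷_)) β +_) (pick-tail n inv [] c β p)
choices-tail n {φ} inv (d ∷ α) c β p = cong₂ _+_
  (choices-tail n (cons inv (kill d)) α c β p)
  (cong₂ χ (cong (rowClear d ∨_) (vacant-kill α c β)) (pick-tail n inv (d ∷ α) c β p))
pick-tail zero {φ} inv []     c β p = trans (inv .tail [] (mark c) β p)
                                            (cong (λ d → φ (d ∷ β)) (sym (mark-kill c)))
pick-tail (suc n) inv []      c β p = refl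
pick-tail zero    inv (d ∷ α) c β p = inv .tail (mark d ∷ α) c β p
pick-tail (suc n) inv (d ∷ α) c β p = choices-tail n (cons inv ●) α c β p

private
  regroup₁ : ∀ a b c → (a + c) + (b + 0) ≡ (a + 0) + (b + c)
  regroup₁ = solve-∀

  regroup₂ : ∀ a b c d → (a + c) + (b + d) ≡ (a + b) + (c + d)
  regroup₂ = solve-∀

-- An occupied letter in `β` makes the freedom of the letters of `α` independent of the exchanged
-- letter. Unchosen before a later choice, that letter leaves one ● and one ○ on each side; it can
-- be chosen only as ◆ or ◇, with the same outcome. If the last choice is in `α`, `inv .exchange`
-- applies.
choices-exchange : ∀ n {φ} → Invariant φ → ∀ α β → vacant β ≡ false →
  choices n φ (α ++ ◆ ∷ β) + choices n φ (α ++ ○ ∷ β) ≡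
  choices n φ (α ++ ● ∷ β) + choices n φ (α ++ ◇ ∷ β)
pick-exchange : ∀ n {φ} → Invariant φ → ∀ d α β → vacant β ≡ false →
  pick n φ (d ∷ α ++ ◆ ∷ β) + pick n φ (d ∷ α ++ ○ ∷ β) ≡
  pick n φ (d ∷ α ++ ● ∷ β) + pick n φ (d ∷ α ++ ◇ ∷ β)
choices-exchange n {φ} inv [] β p rewrite p with n
... | zero  = regroup₁ (choices zero (φ ∘ (● ∷_)) β) (choices zero (φ ∘ (○ ∷_)) β) _
... | suc n = regroup₁ (choices (suc n) (φ ∘ (● ∷_)) β) (choices (suc n) (φ ∘ (○ ∷_)) β) _
choices-exchange n {φ} inv (d ∷ α) β p
  rewrite free-occupied d α ◆ β p | free-occupied d α ○ β p | free-occupied d α ● β p | free-occupied d α ◇ β p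
  = trans (regroup₂ (choices n φd (α ++ ◆ ∷ β)) _ (χ f (pick n φ (d ∷ α ++ ◆ ∷ β))) _)
   (trans (cong₂ _+_ (choices-exchange n (cons inv (kill d)) α β p)
     (trans (sym (χ-+ f _ _)) (trans (cong (χ f) (pick-exchange n inv d α β p)) (χ-+ f _ _))))
          (sym (regroup₂ (choices n φd (α ++ ● ∷ β)) _ (χ f (pick n φ (d ∷ α ++ ● ∷ β))) _)))
  where
  f = rowClear d ∨ false
  φd = φ ∘ (kill d ∷_)
pick-exchange zero    inv d α β p = inv .exchange (mark d ∷ α) β
pick-exchange (suc n) inv d α β p = choices-exchange n (cons inv ●) α β p

-- Choosing n + 1 of k + 1 allowed cells, the leftmost of which becomes the last allowed one; the
-- arguments of g are one less than the number of allowed cells, and the number of forbidden cells.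
stair : ℕ → (ℕ → ℕ → ℕ) → ℕ → ℕ → ℕ
stair zero    g zero    j = g zero j
stair (suc n) g zero    j = 0
stair zero    g (suc k) j = g (suc k) j + stair zero g k (suc j)
stair (suc n) g (suc k) j = stair (suc n) g k (suc j) + stair n g k (suc j)

-- Runs and the recursion of the chain model

onRuns : (Word → ℕ) → ℕ → ℕ → ℕ
onRuns φ k j = φ (run k (suc j))

private
  regroup₃ : ∀ a b c d e → c + a ≡ e + d → (a + b) + c ≡ d + (b + e)
  regroup₃ a b c d e h = trans (lhs a b c) (trans (cong (_+ b) h) (rhs d b e))
    where
    lhs : ∀ a b c → (a + b) + c ≡ (c + a) + b
    lhs = solve-∀
    rhs : ∀ d b e → (e + d) + b ≡ d + (b + e)
    rhs = solve-∀

  regroup₄ : ∀ a b c d → (a + b) + (c + d) ≡ (a + d) + (b + c)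
  regroup₄ = solve-∀

  regroup₅ : ∀ a b c d → (a + b) + (c + d) ≡ (a + c) + (b + d)
  regroup₅ = solve-∀

-- The left side splits off the leftmost ◇ (unchosen it becomes ○, chosen alone ◆), the right side
-- the rightmost allowed cell. `exchange` trades ○ and ◆ for ◇ and ●, and `rotate` turns the ● into
-- the ◆ of the shorter run.
stair-zero : ∀ {φ} → Invariant φ → ∀ k j →
  stair zero (onRuns (φ ∘ (○ ∷_))) k j + φ (◆ ∷ run k (suc j)) ≡ stair zero (onRuns φ) (suc k) j
stair-zero {φ} inv zero    j =
  trans (+-comm (φ (○ ∷ qs)) _) (trans (inv .exchange [] qs) (+-comm (φ (● ∷ qs)) _))
  where qs = run 0 (suc j)
stair-zero {φ} inv (suc k) j =
  trans (regroup₃ (φ (○ ∷ w)) (stair zero (onRuns (φ ∘ (○ ∷_))) k (suc j)) (φ (◆ ∷ w)) (φ (◇ ∷ w)) (φ (● ∷ w))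
          (inv .exchange [] w))
        (cong (φ (◇ ∷ w) +_)
          (trans (cong (stair zero (onRuns (φ ∘ (○ ∷_))) k (suc j) +_) (inv .rotate [] k (suc j)))
                 (stair-zero inv k (suc j))))
  where w = run (suc k) (suc j)

-- Here the leftmost ◇, if chosen, is followed by further choices and becomes ●. Splitting both
-- terms at the rightmost allowed cell gives the same identity for smaller parameters, down to
-- `stair-zero`, which is reached through `rotate`.
stair-suc : ∀ n {φ} → Invariant φ → ∀ k j →
  stair (suc n) (onRuns (φ ∘ (○ ∷_))) k j + stair n (onRuns (φ ∘ (● ∷_))) k j ≡
  stair (suc n) (onRuns φ) (suc k) j
stair-suc zero    inv zero    j = refl
stair-suc (suc n) inv zero    j = refl
stair-suc zero {φ} inv (suc k) j =
  trans (regroup₄ (stair 1 (onRuns (φ ∘ (○ ∷_))) k (suc j)) (stair 0 (onRuns (φ ∘ (○ ∷_))) k (suc j)) _ _)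
        (cong₂ _+_ (stair-suc zero inv k (suc j))
          (trans (cong (stair 0 (onRuns (φ ∘ (○ ∷_))) k (suc j) +_) (inv .rotate [] k (suc j)))
                 (stair-zero inv k (suc j))))
stair-suc (suc n) {φ} inv (suc k) j =
  trans (regroup₅ (stair (suc (suc n)) (onRuns (φ ∘ (○ ∷_))) k (suc j)) _ _ _)
        (cong₂ _+_ (stair-suc (suc n) inv k (suc j)) (stair-suc n inv k (suc j)))

vacant-run : ∀ k j → vacant (run k (suc j)) ≡ false
vacant-run zero    j = refl
vacant-run (suc k) j = vacant-run k j

vacant-◇ : ∀ k → vacant (run k 0) ≡ true
vacant-◇ zero    = refl
vacant-◇ (suc k) = vacant-◇ k

choices-run : ∀ n {φ} → Invariant φ → ∀ k j → choices n φ (run k (suc j)) ≡ stair n (onRuns φ) k j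
choices-run zero    inv zero zero = refl
choices-run (suc n) inv zero zero = refl
choices-run n {φ} inv zero (suc j) =
  trans (+-identityʳ _) (trans (choices-run n (cons inv ●) zero j) (shift n))
  where
  shift : ∀ n → stair n (onRuns (φ ∘ (● ∷_))) zero j ≡ stair n (onRuns φ) zero (suc j)
  shift zero    = refl
  shift (suc n) = refl
choices-run zero {φ} inv (suc k) j =
  trans (cong (_+ φ (◆ ∷ run k (suc j))) (choices-run zero (cons inv ○) k j)) (stair-zero inv k j)
choices-run (suc n) inv (suc k) j =
  trans (cong₂ _+_ (choices-run (suc n) (cons inv ○) k j) (choices-run n (cons inv ●) k j))
        (stair-suc n inv k j)

-- The last letter is free as ◇ and as ●. When an earlier ◇ is the only choice, `tail` and then
-- `rotate` convert the resulting words.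
choices-◇ : ∀ n {φ} → Invariant φ → ∀ k → choices n φ (run (suc k) 0) ≡ choices n φ (run k 1)
choices-◇ zero    inv zero = inv .tail [] ◆ [] refl
choices-◇ (suc n) inv zero = refl
choices-◇ zero    inv (suc k) = cong₂ _+_ (choices-◇ zero (cons inv ○) k)
  (trans (inv .tail [] ◆ (run (suc k) 0) (vacant-◇ (suc k))) (inv .rotate [] k 0))
choices-◇ (suc n) inv (suc k) = cong₂ _+_ (choices-◇ (suc n) (cons inv ○) k) (choices-◇ n (cons inv ●) k)

choices-invariant : ∀ n {φ} → Invariant φ → Invariant (choices n φ)
choices-invariant n inv .tail = choices-tail n inv
choices-invariant n inv .exchange α β with vacant β in eq
-- With `β` vacant, the exchange relation splits into two instances of the tail relation.
... | true  = cong₂ _+_ (choices-tail n inv α ◆ β eq) (sym (choices-tail n inv α ◇ β eq))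
... | false = choices-exchange n inv α β eq
choices-invariant n {φ} inv .rotate = go n inv
  where
  vacant-runs : ∀ α i m → vacant (α ++ ● ∷ run (suc i) m) ≡ vacant (α ++ ◆ ∷ run i (suc m))
  vacant-runs α i m = trans (meets α ● refl) (sym (meets α ◆ refl))
    where
    meets : ∀ α c {β} → occupied c ≡ true → vacant (α ++ c ∷ β) ≡ false
    meets α c {β} p = vacant-++ α (c ∷ β) (cong (λ b → not b ∧ vacant β) p)
  go : ∀ n {φ} → Invariant φ → ∀ α i m →
       choices n φ (α ++ ● ∷ run (suc i) m) ≡ choices n φ (α ++ ◆ ∷ run i (suc m))
  -- An occupied letter follows, so the first ● is not free, while ◆ on the other side is. Splitting
  -- `stair` at its last allowed cell produces the missing term, up to `rotate`.
  go zero {φ} inv [] i (suc m) rewrite vacant-run i m = trans (+-identityʳ _)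
    (trans (choices-run 0 (cons inv ●) (suc i) m)
    (trans (+-comm (φ (● ∷ run (suc i) (suc m))) _)
           (cong₂ _+_ (sym (choices-run 0 (cons inv ●) i (suc m))) (inv .rotate [] i (suc m)))))
  go (suc n) {φ} inv [] i (suc m) rewrite vacant-run i m = trans (+-identityʳ _)
    (trans (choices-run (suc n) (cons inv ●) (suc i) m)
           (cong₂ _+_ (sym (choices-run (suc n) (cons inv ●) i (suc m)))
                      (sym (choices-run n (cons inv ●) i (suc m)))))
  -- Only ◇'s follow, so the first ● is free by vacancy, as ◆ is by its flag.
  go zero {φ} inv [] i zero rewrite vacant-◇ i =
    cong₂ _+_ (choices-◇ zero (cons inv ●) i) (inv .rotate [] i zero)
  go (suc n) inv [] i zero rewrite vacant-◇ i =
    cong₂ _+_ (choices-◇ (suc n) (cons inv ●) i) (choices-◇ n (cons inv ●) i)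
  go zero inv (d ∷ α) i m = cong₂ _+_ (go zero (cons inv (kill d)) α i m)
    (cong₂ χ (cong (rowClear d ∨_) (vacant-runs α i m)) (inv .rotate (mark d ∷ α) i m))
  go (suc n) inv (d ∷ α) i m = cong₂ _+_ (go (suc n) (cons inv (kill d)) α i m)
    (cong₂ χ (cong (rowClear d ∨_) (vacant-runs α i m)) (go n (cons inv ●) α i m))

-- Dropping columns on the right, adding columns on the left

vacant-take : ∀ k β → vacant β ≡ true → vacant (take k β) ≡ true
vacant-take zero    β       p = refl
vacant-take (suc k) []      p = refl
vacant-take (suc k) (○ ∷ β) p = vacant-take k β p
vacant-take (suc k) (◇ ∷ β) p = vacant-take k β p

take-◇ : ∀ k w → take k (run w 0) ≡ run (k ⊓ w) 0
take-◇ zero    w       = refl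
take-◇ (suc k) zero    = refl
take-◇ (suc k) (suc w) = cong (◇ ∷_) (take-◇ k w)

take-● : ∀ k m → take k (run 0 m) ≡ run 0 (k ⊓ m)
take-● zero    m       = refl
take-● (suc k) zero    = refl
take-● (suc k) (suc m) = cong (● ∷_) (take-● k m)

take-invariant : ∀ k {φ} → Invariant φ → Invariant (φ ∘ take k)
take-invariant k inv .tail α c β p = go k α inv
  where
  go : ∀ k α {φ} → Invariant φ → φ (take k (α ++ c ∷ β)) ≡ φ (take k (α ++ kill c ∷ β))
  go zero    α       inv = refl
  go (suc k) []      inv = inv .tail [] c (take k β) (vacant-take k β p)
  go (suc k) (d ∷ α) inv = go k α (cons inv d)
take-invariant k inv .exchange α β = go k α inv
  where
  go : ∀ k α {φ} → Invariant φ →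
       φ (take k (α ++ ◆ ∷ β)) + φ (take k (α ++ ○ ∷ β)) ≡
       φ (take k (α ++ ● ∷ β)) + φ (take k (α ++ ◇ ∷ β))
  go zero    α       inv = refl
  go (suc k) []      inv = inv .exchange [] (take k β)
  go (suc k) (d ∷ α) inv = go k α (cons inv d)
take-invariant k inv .rotate α i m = go k α inv
  where
  -- Either the cut falls among the ◇'s of both words, or it removes only trailing ●'s.
  cut : ∀ k i → (∃ λ l → take k (run (suc i) m) ≡ run l 0 × take k (run i (suc m)) ≡ run l 0)
              ⊎ (∃ λ l → take k (run (suc i) m) ≡ run (suc i) l × take k (run i (suc m)) ≡ run i (suc l))
  cut zero    i       = inj₁ (0 , refl , refl)
  cut (suc k) zero    = inj₂ (k ⊓ m , cong (◇ ∷_) (take-● k m) , cong (● ∷_) (take-● k m))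
  cut (suc k) (suc i) with cut k i
  ... | inj₁ (l , p , p′) = inj₁ (suc l , cong (◇ ∷_) p , cong (◇ ∷_) p′)
  ... | inj₂ (l , p , p′) = inj₂ (l , cong (◇ ∷_) p , cong (◇ ∷_) p′)
  go : ∀ k α {φ} → Invariant φ → φ (take k (α ++ ● ∷ run (suc i) m)) ≡ φ (take k (α ++ ◆ ∷ run i (suc m)))
  go zero    α       inv = refl
  go (suc k) (d ∷ α) inv = go k α (cons inv d)
  go (suc k) []      {φ} inv with cut k i
  ... | inj₁ (l , p , p′) rewrite p | p′ = sym (inv .tail [] ◆ (run l 0) (vacant-◇ l))
  ... | inj₂ (l , p , p′) rewrite p | p′ = inv .rotate [] i l

-- φ counts completions of words; ψ k j counts those of the chain model with k allowed cells followed
-- by j forbidden ones.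
record Tracks (φ : Word → ℕ) (ψ : ℕ → ℕ → ℕ) : Set where
  field
    invariant : Invariant φ
    unmarked  : ∀ w → φ (run w 0) ≡ ψ w 0
    marked    : ∀ k j → φ (run k (suc j)) ≡ ψ (suc k) j

open Tracks

addRow : ℕ → (Word → ℕ) → Word → ℕ
addRow zero    φ = φ
addRow (suc n) φ = choices n φ

addIntervalRow : ℕ → (ℕ → ℕ → ℕ) → ℕ → ℕ → ℕ
addIntervalRow zero    ψ k       j = ψ k j
addIntervalRow (suc n) ψ zero    j = 0
addIntervalRow (suc n) ψ (suc k) j = stair n (ψ ∘ suc) k j

stair-cong : ∀ n {g h : ℕ → ℕ → ℕ} → (∀ k j → g k j ≡ h k j) → ∀ k j → stair n g k j ≡ stair n h k j
stair-cong zero    e zero    j = e zero j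
stair-cong (suc n) e zero    j = refl
stair-cong zero    e (suc k) j = cong₂ _+_ (e (suc k) j) (stair-cong zero e k (suc j))
stair-cong (suc n) e (suc k) j = cong₂ _+_ (stair-cong (suc n) e k (suc j)) (stair-cong n e k (suc j))

addRow-tracks : ∀ n {φ ψ} → Tracks φ ψ → Tracks (addRow n φ) (addIntervalRow n ψ)
addRow-tracks zero    t = t
addRow-tracks (suc n) t .invariant = choices-invariant n (t .invariant)
addRow-tracks (suc n) t .unmarked zero = refl
addRow-tracks (suc n) t .unmarked (suc w) =
  trans (choices-◇ n (t .invariant) w) (addRow-tracks (suc n) t .marked w 0)
addRow-tracks (suc n) t .marked k j =
  trans (choices-run n (t .invariant) k j) (stair-cong n (t .marked) k j)

-- If some ● survives the cut, the last survivor becomes the free one, so only forbidden cells are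
-- lost; otherwise only ◇'s remain, all of them allowed.
take-tracks : ∀ m {φ ψ} → Tracks φ ψ → Tracks (φ ∘ take m) (λ k j → ψ (m ⊓ k) ((m ∸ k) ⊓ j))
take-tracks m t .invariant = take-invariant m (t .invariant)
take-tracks m {φ} {ψ} t .unmarked w = trans (cong φ (take-◇ m w))
  (trans (t .unmarked (m ⊓ w)) (cong (ψ (m ⊓ w)) (sym (⊓-zeroʳ (m ∸ w)))))
take-tracks m {φ} {ψ} t .marked k j = go m k {ψ = ψ} (t .invariant) (t .unmarked) (t .marked)
  where
  go : ∀ m k {φ} {ψ : ℕ → ℕ → ℕ} → Invariant φ → (∀ w → φ (run w 0) ≡ ψ w 0) →
       (∀ k j → φ (run k (suc j)) ≡ ψ (suc k) j) →
       φ (take m (run k (suc j))) ≡ ψ (m ⊓ suc k) ((m ∸ suc k) ⊓ j)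
  go zero    k       inv u mk = u 0
  go (suc m) zero    {φ} {ψ} inv u mk rewrite ⊓-zeroʳ m = trans (cong (λ w → φ (● ∷ w)) (take-● m j)) (mk 0 (m ⊓ j))
  go (suc m) (suc k) {φ} {ψ} inv u mk =
    go m k {φ ∘ (◇ ∷_)} {ψ ∘ suc} (cons inv ◇) (λ w → u (suc w)) (λ k → mk (suc k))

prepend-tracks : ∀ l {φ ψ} → Tracks φ ψ → Tracks (φ ∘ (run l 0 ++_)) (λ k j → ψ (l + k) j)
prepend-tracks zero    t = t
prepend-tracks (suc l) {φ} {ψ} t = prepend-tracks l {φ ∘ (◇ ∷_)} {ψ ∘ suc} record
  { invariant = cons (t .invariant) ◇
  ; unmarked  = λ w → t .unmarked (suc w)
  ; marked    = λ k → t .marked (suc k)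
  }

-- Counting matrices row by row

Row : ℕ → Set
Row = Vec Bool

sumOver : ∀ {A : Set} → List A → (A → ℕ) → ℕ
sumOver xs f = sum (map f xs)

vecs : ∀ {A : Set} → List A → ∀ n → List (Vec A n)
vecs xs zero    = [] ∷ []
vecs xs (suc n) = cartesianProductWith _∷_ xs (vecs xs n)

rows : ∀ W → List (Row W)
rows = vecs (false ∷ true ∷ [])

sumOver-++ : ∀ {A : Set} (xs ys : List A) f → sumOver (xs ++ ys) f ≡ sumOver xs f + sumOver ys f
sumOver-++ xs ys f = trans (cong sum (map-++ f xs ys)) (sum-++ (map f xs) (map f ys))

sumOver-cong : ∀ {A : Set} (xs : List A) {f g} → (∀ x → f x ≡ g x) → sumOver xs f ≡ sumOver xs g
sumOver-cong xs e = cong sum (map-cong e xs)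

sumOver-zero : ∀ {A : Set} (xs : List A) → sumOver xs (λ _ → 0) ≡ 0
sumOver-zero []       = refl
sumOver-zero (x ∷ xs) = sumOver-zero xs

sumOver-χ : ∀ {A : Set} (xs : List A) b f → sumOver xs (λ x → χ b (f x)) ≡ χ b (sumOver xs f)
sumOver-χ xs true  f = refl
sumOver-χ xs false f = sumOver-zero xs

sumOver-product : ∀ {A B C : Set} (_∙_ : A → B → C) xs ys f →
  sumOver (cartesianProductWith _∙_ xs ys) f ≡ sumOver xs (λ x → sumOver ys (λ y → f (x ∙ y)))
sumOver-product _∙_ []       ys f = refl
sumOver-product _∙_ (x ∷ xs) ys f =
  trans (sumOver-++ (map (x ∙_) ys) (cartesianProductWith _∙_ xs ys) f)
        (cong₂ _+_ (cong sum (sym (map-∘ ys))) (sumOver-product _∙_ xs ys f))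

sumOver-rows : ∀ W (f : Row (suc W) → ℕ) →
  sumOver (rows (suc W)) f ≡ sumOver (rows W) (f ∘ (false ∷_)) + sumOver (rows W) (f ∘ (true ∷_))
sumOver-rows W f = trans (sumOver-product _∷_ (false ∷ true ∷ []) (rows W) f)
                         (cong (sumOver (rows W) (f ∘ (false ∷_)) +_) (+-identityʳ _))

χ-∧ : ∀ a b n → χ (a ∧ b) n ≡ χ a (χ b n)
χ-∧ true  b n = refl
χ-∧ false b n = refl

χ-zero : ∀ b → χ b 0 ≡ 0
χ-zero true  = refl
χ-zero false = refl

χ-comm : ∀ a b n → χ a (χ b n) ≡ χ b (χ a n)
χ-comm true  b n = refl
χ-comm false b n = sym (χ-zero b)

-- Under the indicator of a row size, a state update that depends on that size may be computed from
-- the prescribed number instead.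
χ-≡ᵇ : ∀ m n (f : ℕ → ℕ) → χ (m ≡ᵇ n) (f m) ≡ χ (m ≡ᵇ n) (f n)
χ-≡ᵇ zero    zero    f = refl
χ-≡ᵇ zero    (suc n) f = refl
χ-≡ᵇ (suc m) zero    f = refl
χ-≡ᵇ (suc m) (suc n) f = χ-≡ᵇ m n (f ∘ suc)

rowSums : ∀ {W H} → Vec (Row W) H → Vec ℕ H
rowSums = Vec.map ∣_∣

_≟ᵛ_ : ∀ {n} → DecidableEquality (Vec ℕ n)
_≟ᵛ_ = ≡-dec _≟_

-- Both classes of fillings are read by a deterministic scan of the rows from top to bottom; `m`
-- marks the cells of the shape in the current row.
module Scan {W} {State : Set} (ok : Row W → State → Row W → Bool)
            (next : Row W → State → Row W → State) where

  accept : ∀ {H} → Vec (Row W) H → State → Vec (Row W) H → Bool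
  accept []       s []       = true
  accept (m ∷ ms) s (X ∷ Xs) = ok m s X ∧ accept ms (next m s X) Xs

  completions : ∀ {H} → Vec (Row W) H → State → Vec ℕ H → ℕ
  completions []       s []      = 1
  completions (m ∷ ms) s (n ∷ v) =
    sumOver (rows W) λ X → χ (ok m s X) (χ (∣ X ∣ ≡ᵇ n) (completions ms (next m s X) v))

  -- Turns the recursion over rows into a count of accepted matrices: the conditions on the first
  -- row come out of the sum over the others.
  completions-count : ∀ {H} (ms : Vec (Row W) H) s v →
    sumOver (vecs (rows W) H) (λ Xs → χ (accept ms s Xs) (χ (does (rowSums Xs ≟ᵛ v)) 1)) ≡ completions ms s v
  completions-count []       s []      = refl
  completions-count {suc H} (m ∷ ms) s (n ∷ v) =
    trans (sumOver-product _∷_ (rows W) (vecs (rows W) H) _) (sumOver-cong (rows W) λ X →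
    trans (sumOver-cong (vecs (rows W) H) (λ Xs →
             trans (χ-∧ (ok m s X) _ _) (cong (χ (ok m s X))
               (trans (cong (χ (accept ms (next m s X) Xs)) (χ-∧ (∣ X ∣ ≡ᵇ n) _ 1))
                      (χ-comm (accept ms (next m s X) Xs) (∣ X ∣ ≡ᵇ n) _)))))
    (trans (sumOver-χ (vecs (rows W) H) (ok m s X) _)
           (cong (χ (ok m s X)) (trans (sumOver-χ (vecs (rows W) H) (∣ X ∣ ≡ᵇ n) _)
                                       (cong (χ (∣ X ∣ ≡ᵇ n)) (completions-count ms (next m s X) v))))))

-- The word model as a scan

select : ∀ {W} → Row W → Vec Letter W → Word
select []          []      = []
select (false ∷ m) (c ∷ u) = select m u
select (true  ∷ m) (c ∷ u) = c ∷ select m u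

put : ∀ {W} → Row W → Vec Letter W → Word → Vec Letter W
put []          []      w       = []
put (false ∷ m) (c ∷ u) w       = c ∷ put m u w
put (true  ∷ m) (c ∷ u) []      = c ∷ put m u []
put (true  ∷ m) (c ∷ u) (d ∷ w) = d ∷ put m u w

-- A column loses its clear flag only in a row that meets it; `more` tells whether that row has a
-- 1-cell further right.
update : Bool → Bool → Bool → Letter → Letter
update inside chosen more c = (if inside ∧ more then kill else λ d → d) (if chosen then mark c else c)

okWord : ∀ {W} → Row W → Vec Letter W → Row W → Bool
okWord []      []      []      = true
okWord (b ∷ m) (c ∷ u) (x ∷ X) = (not x ∨ (b ∧ free c (select m u))) ∧ okWord m u X

nextWord : ∀ {W} → Row W → Vec Letter W → Row W → Vec Letter W
nextWord []      []      []      = []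
nextWord (b ∷ m) (c ∷ u) (x ∷ X) = update b x (0 <ᵇ ∣ X ∣) c ∷ nextWord m u X

put-select : ∀ {W} (m : Row W) u → put m u (select m u) ≡ u
put-select []          []      = refl
put-select (false ∷ m) (c ∷ u) = cong (c ∷_) (put-select m u)
put-select (true  ∷ m) (c ∷ u) = cong (c ∷_) (put-select m u)

kill-mark : ∀ c → kill (mark c) ≡ ●
kill-mark ○ = refl
kill-mark ◇ = refl
kill-mark ● = refl
kill-mark ◆ = refl

-- One row of the scan is one application of `addRow` to the letters inside the shape. By `χ-≡ᵇ` the
-- flag `more` is read off from the prescribed size; `last` matches the two clauses of `pick`.
sum-wordRow : ∀ {W} (m : Row W) u n (Φ : Vec Letter W → ℕ) →
  sumOver (rows W) (λ X → χ (okWord m u X) (χ (∣ X ∣ ≡ᵇ n) (Φ (nextWord m u X)))) ≡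
  addRow n (Φ ∘ put m u) (select m u)
sum-wordRow [] [] zero    Φ = +-identityʳ _
sum-wordRow [] [] (suc n) Φ = refl
sum-wordRow {suc W} (false ∷ m) (c ∷ u) n Φ = trans (sumOver-rows W _)
  (trans (cong₂ _+_ (sum-wordRow m u n (Φ ∘ (c ∷_))) (sumOver-zero (rows W))) (+-identityʳ _))
sum-wordRow {suc W} (true ∷ m) (c ∷ u) zero Φ = trans (sumOver-rows W _) (trans (cong₂ _+_
  (trans (sumOver-cong (rows W) λ X → cong (χ (okWord m u X))
           (χ-≡ᵇ ∣ X ∣ 0 (λ n → Φ (update true false (0 <ᵇ n) c ∷ nextWord m u X))))
         (sum-wordRow m u 0 (Φ ∘ (c ∷_))))
  (trans (sumOver-cong (rows W) λ X → χ-zero (free c (select m u) ∧ okWord m u X)) (sumOver-zero (rows W))))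
  (+-identityʳ _))
sum-wordRow {suc W} (true ∷ m) (c ∷ u) (suc n) Φ = trans (sumOver-rows W _) (cong₂ _+_
  (trans (sumOver-cong (rows W) λ X → cong (χ (okWord m u X))
           (χ-≡ᵇ ∣ X ∣ (suc n) (λ n → Φ (update true false (0 <ᵇ n) c ∷ nextWord m u X))))
         (sum-wordRow m u (suc n) (Φ ∘ (kill c ∷_))))
  (trans (sumOver-cong (rows W) λ X →
           trans (χ-∧ (free c (select m u)) (okWord m u X) _)
                 (cong (χ (free c (select m u)) ∘ χ (okWord m u X))
                   (χ-≡ᵇ ∣ X ∣ n (λ n → Φ (update true true (0 <ᵇ n) c ∷ nextWord m u X)))))
  (trans (sumOver-χ (rows W) (free c (select m u)) _)
         (cong (χ (free c (select m u)))
           (trans (sum-wordRow m u n (Φ ∘ (update true true (0 <ᵇ n) c ∷_))) (last n))))))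
  where
  last : ∀ n → addRow n (Φ ∘ (update true true (0 <ᵇ n) c ∷_) ∘ put m u) (select m u) ≡
               pick n (Φ ∘ put (true ∷ m) (c ∷ u)) (c ∷ select m u)
  last zero    = refl
  last (suc n) rewrite kill-mark c = refl

-- Rows as windows

interval : ℕ → ℕ → ∀ W → Row W
interval p       k       zero    = []
interval (suc p) k       (suc W) = false ∷ interval p k W
interval zero    zero    (suc W) = false ∷ interval zero zero W
interval zero    (suc k) (suc W) = true ∷ interval zero k W

select-interval : ∀ p k {W} (u : Vec Letter W) → select (interval p k W) u ≡ take k (drop p (toList u))
select-interval zero    zero    []      = refl
select-interval zero    (suc k) []      = refl
select-interval (suc p) zero    []      = refl
select-interval (suc p) (suc k) []      = refl
select-interval (suc p) k       (c ∷ u) = select-interval p k u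
select-interval zero    zero    (c ∷ u) = select-interval zero zero u
select-interval zero    (suc k) (c ∷ u) = cong (c ∷_) (select-interval zero k u)

select-put : ∀ {W} (m : Row W) u w → length w ≡ length (select m u) → select m (put m u w) ≡ w
select-put []          []      []      e = refl
select-put (false ∷ m) (c ∷ u) w       e = select-put m u w e
select-put (true  ∷ m) (c ∷ u) (d ∷ w) e = cong (d ∷_) (select-put m u w (suc-injective e))

take-put : ∀ p k {W} (u : Vec Letter W) w →
           take p (toList (put (interval p k W) u w)) ≡ take p (toList u)
take-put zero    k u       w = refl
take-put (suc p) k []      w = refl
take-put (suc p) k (c ∷ u) w = cong (c ∷_) (take-put p k u w)

-- `addRow` evaluates its function only at words of the given length, which is the condition in
-- `select-put`.
addRow-cong : ∀ n {φ φ′ : Word → ℕ} w → (∀ w′ → length w′ ≡ length w → φ w′ ≡ φ′ w′) → addRow n φ w ≡ addRow n φ′ w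
addRow-cong zero    w e = e w refl
addRow-cong (suc n) w e = go n w e
  where
  go : ∀ n {φ φ′ : Word → ℕ} w → (∀ w′ → length w′ ≡ length w → φ w′ ≡ φ′ w′) →
       choices n φ w ≡ choices n φ′ w
  go n       []      e = refl
  go zero    (c ∷ w) e = cong₂ _+_ (go zero w λ w′ l → e _ (cong suc l)) (cong (χ (free c w)) (e _ refl))
  go (suc n) (c ∷ w) e = cong₂ _+_ (go (suc n) w λ w′ l → e _ (cong suc l))
                                   (cong (χ (free c w)) (go n w λ w′ l → e _ (cong suc l)))

-- (p , k) stands for the k columns p, p + 1, …, counted from 0.
Window : Set
Window = ℕ × ℕ

-- Going down a skew shape, both ends of a row move weakly to the left.
_≼_ : Window → Window → Set
(p′ , k′) ≼ (p , k) = p′ ≤ p × p′ + k′ ≤ p + k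

mask : ∀ W → Window → Row W
mask W (p , k) = interval p k W

masks : ∀ W {H} → Vec Window H → Vec (Row W) H
masks W = Vec.map (mask W)

data Descending : ∀ {H} → Window → Vec Window H → Set where
  []  : ∀ {w} → Descending w []
  _∷_ : ∀ {w w′ H} {ws : Vec Window H} → w′ ≼ w → Descending w′ ws → Descending w (w′ ∷ ws)

-- `p` is the start of the previous window: `run (p ∸ p′) 0` holds the blank columns gained on the
-- left, and `take k` drops those lost on the right.
wordCount : ∀ {H} → ℕ → Vec Window H → Vec ℕ H → Word → ℕ
wordCount p []              []      w = 1
wordCount p ((p′ , k) ∷ ws) (n ∷ v) w = addRow n (wordCount p′ ws v) (take k (run (p ∸ p′) 0 ++ w))

intervalCount : ∀ {H} → ℕ → Vec Window H → Vec ℕ H → ℕ → ℕ → ℕ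
intervalCount p []              []      a b = 1
intervalCount p ((p′ , k) ∷ ws) (n ∷ v) a b =
  addIntervalRow n (intervalCount p′ ws v) (k ⊓ (p ∸ p′ + a)) ((k ∸ (p ∸ p′ + a)) ⊓ b)

count-tracks : ∀ {H} p (ws : Vec Window H) v → Tracks (wordCount p ws v) (intervalCount p ws v)
count-tracks p [] [] = record
  { invariant = record { tail = λ _ _ _ _ → refl ; exchange = λ _ _ → refl ; rotate = λ _ _ _ → refl }
  ; unmarked  = λ _ → refl
  ; marked    = λ _ _ → refl
  }
count-tracks p ((p′ , k) ∷ ws) (n ∷ v) =
  prepend-tracks (p ∸ p′) (take-tracks k (addRow-tracks n (count-tracks p′ ws v)))

private
  take-take : ∀ {A : Set} {k l} (xs : List A) → k ≤ l → take k xs ≡ take k (take l xs)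
  take-take xs       z≤n       = refl
  take-take []       (s≤s k≤l) = refl
  take-take (x ∷ xs) (s≤s k≤l) = cong (x ∷_) (take-take xs k≤l)

-- The next window ends no further right than the current one, and all columns left of the current
-- one are blank, so its letters are determined by those of the current window.
reshape : ∀ p k p′ k′ (l : Word) → take p l ≡ run p 0 → p′ ≤ p → p′ + k′ ≤ p + k →
          take k′ (drop p′ l) ≡ take k′ (run (p ∸ p′) 0 ++ take k (drop p l))
reshape zero    k .zero    k′       l       e  z≤n      h = take-take l h
reshape (suc p) k .zero    zero     l       e  z≤n      h = refl
reshape (suc p) k .zero    (suc k′) (◇ ∷ l) e  z≤n      (s≤s h) =
  cong (◇ ∷_) (reshape p k zero k′ l (∷-injectiveʳ e) z≤n h)
reshape (suc p) k (suc p′) k′       (x ∷ l) e  (s≤s le) (s≤s h) = reshape p k p′ k′ l (∷-injectiveʳ e) le h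

module Words {W} = Scan {W} okWord nextWord

take-shorter : ∀ p p′ (l : Word) → take p l ≡ run p 0 → p′ ≤ p → take p′ l ≡ run p′ 0
take-shorter p       zero     l       e le       = refl
take-shorter (suc p) (suc p′) (◇ ∷ l) e (s≤s le) = cong (◇ ∷_) (take-shorter p p′ l (∷-injectiveʳ e) le)

-- The scan keeps a letter for every column, `wordCount` only those of the window. The hypothesis on
-- `u` says that the columns not yet entered on the left are still ◇.
completions-word : ∀ {W H p k} {ws : Vec Window H} → Descending (p , k) ws → ∀ v (u : Vec Letter W) →
  take p (toList u) ≡ run p 0 →
  Words.completions (masks W ws) u v ≡ wordCount p ws v (take k (drop p (toList u)))
completions-word []         []      u e = refl
completions-word {W} {p = p} {k} (_∷_ {w′ = p′ , k′} {ws = ws} (h₁ , h₂) d) (n ∷ v) u e =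
  trans (sum-wordRow m u n (λ u′ → Words.completions (masks W ws) u′ v))
  (trans (addRow-cong n (select m u) λ w l →
     trans (completions-word d v (put m u w)
             (trans (take-put p′ k′ u w) (take-shorter p p′ (toList u) e h₁)))
           (cong (wordCount p′ ws v) (trans (sym (select-interval p′ k′ (put m u w))) (select-put m u w l))))
         (cong (addRow n (wordCount p′ ws v))
           (trans (select-interval p′ k′ u) (reshape p k p′ k′ (toList u) e h₁ h₂))))
  where m = interval p′ k′ W

-- The limit l of the chain model: only the first l columns are allowed.
okLimit : ∀ {W} → Row W → ℕ → Row W → Bool
okLimit []      l []      = true
okLimit (b ∷ m) l (x ∷ X) = (not x ∨ (b ∧ (0 <ᵇ l))) ∧ okLimit m (pred l) X

-- Counted from 1, so that as a limit it still allows the column of the leftmost 1-cell. An empty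
-- row gives the full width, which leaves any limit up to `W` unchanged.
firstPosition : ∀ {W} → Row W → ℕ
firstPosition []          = 0
firstPosition (true  ∷ X) = 1
firstPosition (false ∷ X) = suc (firstPosition X)

nextLimit : ∀ {W} → Row W → ℕ → Row W → ℕ
nextLimit m l X = l ⊓ firstPosition X

module Limits {W} = Scan {W} okLimit nextLimit

-- Summing over one row of the chain model

sum-limitRow-empty : ∀ {W} (m : Row W) l → l ≤ W → (f : ℕ → ℕ) →
  sumOver (rows W) (λ X → χ (okLimit m l X) (χ (∣ X ∣ ≡ᵇ 0) (f (nextLimit m l X)))) ≡ f l
sum-limitRow-empty [] .zero z≤n f = +-identityʳ _
sum-limitRow-empty {suc W} (b ∷ m) l l≤W f = trans (sumOver-rows W _) (trans (cong₂ _+_ (go l l≤W)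
  (trans (sumOver-cong (rows W) λ X → χ-zero ((b ∧ (0 <ᵇ l)) ∧ okLimit m (pred l) X)) (sumOver-zero (rows W))))
  (+-identityʳ _))
  where
  go : ∀ l → l ≤ suc W → sumOver (rows W)
         (λ X → χ (okLimit m (pred l) X) (χ (∣ X ∣ ≡ᵇ 0) (f (l ⊓ suc (firstPosition X))))) ≡ f l
  go zero    l≤W       = sum-limitRow-empty m zero z≤n (λ _ → f 0)
  go (suc l) (s≤s l≤W) = sum-limitRow-empty m l l≤W (f ∘ suc)

sumOver-*ʳ : ∀ {A : Set} (xs : List A) (f : A → ℕ) c → sumOver xs (λ x → f x * c) ≡ sumOver xs f * c
sumOver-*ʳ []       f c = refl
sumOver-*ʳ (x ∷ xs) f c = trans (cong (f x * c +_) (sumOver-*ʳ xs f c)) (sym (*-distribʳ-+ c (f x) _))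

χ-* : ∀ a b c → χ a (χ b c) ≡ χ a (χ b 1) * c
χ-* true  true  c = sym (+-identityʳ c)
χ-* true  false c = refl
χ-* false b     c = refl

-- Any n of the `k ⊓ x` allowed cells may be filled; the induction is Pascal's rule.
sum-limitRow-size : ∀ {W} k x n → k ≤ W →
  sumOver (rows W) (λ X → χ (okLimit (interval 0 k W) x X) (χ (∣ X ∣ ≡ᵇ n) 1)) ≡ (k ⊓ x) C n
sum-limitRow-size {zero}  .zero   x       zero    z≤n     = refl
sum-limitRow-size {zero}  .zero   x       (suc n) z≤n     = refl
sum-limitRow-size {suc W} zero    x       n       k≤W     = trans (sumOver-rows W _)
  (trans (cong₂ _+_ (sum-limitRow-size {W} 0 (pred x) n z≤n) (sumOver-zero (rows W))) (+-identityʳ _))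
sum-limitRow-size {suc W} (suc k) zero    n       (s≤s h) = trans (sumOver-rows W _)
  (trans (cong₂ _+_ (trans (sum-limitRow-size k 0 n h) (cong (_C n) (⊓-zeroʳ k))) (sumOver-zero (rows W)))
         (+-identityʳ _))
sum-limitRow-size {suc W} (suc k) (suc x) zero    (s≤s h) = trans (sumOver-rows W _)
  (trans (cong₂ _+_ (sum-limitRow-size k x 0 h)
    (trans (sumOver-cong (rows W) λ X → χ-zero (okLimit (interval 0 k W) x X)) (sumOver-zero (rows W))))
    (+-identityʳ _))
sum-limitRow-size {suc W} (suc k) (suc x) (suc n) (s≤s h) = trans (sumOver-rows W _)
  (trans (cong₂ _+_ (sum-limitRow-size k x (suc n) h) (sum-limitRow-size k x n h))
  (trans (+-comm ((k ⊓ x) C suc n) _) (nCk+nC[k+1]≡[n+1]C[k+1] (k ⊓ x) n)))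

-- Sum of f over the positions, counted from 1, of the first of n + 1 cells chosen among a.
minimumSum : ℕ → ℕ → (ℕ → ℕ) → ℕ
minimumSum n zero    f = 0
minimumSum n (suc a) f = (a C n) * f 1 + minimumSum n a (f ∘ suc)

-- Splits on whether the first cell of the window is filled: if so, the new limit is fixed and
-- `sum-limitRow-size` counts the other n ones; otherwise the window and `f` shift by one.
sum-limitRow-nonempty : ∀ {W} p k x n (f : ℕ → ℕ) → p + k ≤ W →
  sumOver (rows W) (λ X → χ (okLimit (interval p k W) (p + x) X)
                            (χ (∣ X ∣ ≡ᵇ suc n) (f (nextLimit (interval p k W) (p + x) X)))) ≡
  minimumSum n (k ⊓ x) (f ∘ (p +_))
sum-limitRow-nonempty {zero}  zero    zero    x       n f h = refl
sum-limitRow-nonempty {suc W} (suc p) k       x       n f (s≤s h) = trans (sumOver-rows W _)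
  (trans (cong₂ _+_ (sum-limitRow-nonempty p k x n (f ∘ suc) h) (sumOver-zero (rows W))) (+-identityʳ _))
sum-limitRow-nonempty {suc W} zero    zero    zero    n f h = trans (sumOver-rows W _)
  (trans (cong₂ _+_ (sum-limitRow-nonempty {W} 0 0 0 n (λ _ → f 0) z≤n) (sumOver-zero (rows W))) (+-identityʳ _))
sum-limitRow-nonempty {suc W} zero    zero    (suc x) n f h = trans (sumOver-rows W _)
  (trans (cong₂ _+_ (sum-limitRow-nonempty {W} 0 0 x n (f ∘ suc) z≤n) (sumOver-zero (rows W))) (+-identityʳ _))
sum-limitRow-nonempty {suc W} zero    (suc k) zero    n f (s≤s h) = trans (sumOver-rows W _)
  (trans (cong₂ _+_ (trans (sum-limitRow-nonempty 0 k 0 n (λ _ → f 0) h)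
                           (cong (λ a → minimumSum n a (λ _ → f 0)) (⊓-zeroʳ k)))
                    (sumOver-zero (rows W)))
         (+-identityʳ _))
sum-limitRow-nonempty {suc W} zero    (suc k) (suc x) n f (s≤s h) = trans (sumOver-rows W _)
  (trans (cong₂ _+_ (sum-limitRow-nonempty 0 k x n (f ∘ suc) h)
    (trans (sumOver-cong (rows W) λ X →
             trans (χ-* (okLimit (interval 0 k W) x X) (∣ X ∣ ≡ᵇ n) _)
                   (cong (λ l → χ (okLimit (interval 0 k W) x X) (χ (∣ X ∣ ≡ᵇ n) 1) * f (suc l)) (⊓-zeroʳ x)))
    (trans (sumOver-*ʳ (rows W) _ (f 1)) (cong (_* f 1) (sum-limitRow-size k x n h)))))
    (+-comm (minimumSum n (k ⊓ x) (f ∘ suc)) _))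

private
  regroup : ∀ a b c d e → (a * c + d) + (b * c + e) ≡ (b + a) * c + (d + e)
  regroup = solve-∀

  swap-first : ∀ a b c → a + (b + c) ≡ b + (a + c)
  swap-first = solve-∀

-- `stair` recurses on the last allowed cell. For a function of the first argument alone, Pascal's
-- rule regroups it by the leftmost chosen cell, as in `minimumSum`.
stair-first : ∀ n (h : ℕ → ℕ) k j → stair n (λ i _ → h i) (suc k) j ≡
                                    (suc k C n) * h 0 + stair n (λ i _ → h (suc i)) k j
stair-first zero          h zero    j = trans (+-comm (h 1) (h 0)) (cong (_+ h 1) (sym (+-identityʳ (h 0))))
stair-first (suc zero)    h zero    j = sym (trans (+-identityʳ _) (+-identityʳ _))
stair-first (suc (suc n)) h zero    j = refl
stair-first zero          h (suc k) j = trans (cong (h (2 + k) +_) (stair-first zero h k (suc j)))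
                                              (swap-first (h (2 + k)) (1 * h 0) _)
stair-first (suc n)       h (suc k) j =
  trans (cong₂ _+_ (stair-first (suc n) h k (suc j)) (stair-first n h k (suc j)))
  (trans (regroup (suc k C suc n) (suc k C n) (h 0) _ _)
         (cong (λ b → b * h 0 + (stair (suc n) (λ i _ → h (suc i)) k (suc j) + stair n (λ i _ → h (suc i)) k (suc j))) (nCk+nC[k+1]≡[n+1]C[k+1] (suc k) n)))

-- The total number of cells is constant along the recursion, so `g` is consulted on one diagonal
-- only and can be traded for a function of the first argument.
stair-onDiagonal : ∀ n {g h : ℕ → ℕ → ℕ} k j → (∀ i i′ → i + i′ ≡ k + j → g i i′ ≡ h i i′) →
                   stair n g k j ≡ stair n h k j
stair-onDiagonal zero    zero    j e = e 0 j refl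
stair-onDiagonal (suc n) zero    j e = refl
stair-onDiagonal zero    (suc k) j e = cong₂ _+_ (e (suc k) j refl)
  (stair-onDiagonal zero k (suc j) λ i i′ p → e i i′ (trans p (+-suc k j)))
stair-onDiagonal (suc n) (suc k) j e = cong₂ _+_
  (stair-onDiagonal (suc n) k (suc j) λ i i′ p → e i i′ (trans p (+-suc k j)))
  (stair-onDiagonal n k (suc j) λ i i′ p → e i i′ (trans p (+-suc k j)))

minimumSum-stair : ∀ n a j (f : ℕ → ℕ) → minimumSum n (suc a) f ≡ stair n (λ i _ → f (suc i)) a j
minimumSum-stair zero    zero    j f = trans (+-identityʳ _) (+-identityʳ _)
minimumSum-stair (suc n) zero    j f = refl
minimumSum-stair n       (suc a) j f =
  trans (cong ((suc a C n) * f 1 +_) (minimumSum-stair n a j (f ∘ suc))) (sym (stair-first n (f ∘ suc) a j))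

-- Truncating the limit to the old window of length k is invisible in the new window, whose length
-- is at most d + k.
⊓-absorbs : ∀ {k k′} d x → k′ ≤ d + k → k′ ⊓ (d + (k ⊓ x)) ≡ k′ ⊓ (d + x)
⊓-absorbs {k} {k′} d x h = trans (cong (k′ ⊓_) (+-distribˡ-⊓ d k x))
  (trans (sym (⊓-assoc k′ (d + k) (d + x))) (cong (_⊓ (d + x)) (m≤n⇒m⊓n≡m h)))

∸-absorbs : ∀ {k k′} d x → k′ ≤ d + k → (k′ ∸ (d + (k ⊓ x))) ⊓ (k ∸ x) ≡ k′ ∸ (d + x)
∸-absorbs {k} {k′} d x h with ≤-total x k
... | inj₁ x≤k = trans (cong (λ m → (k′ ∸ (d + m)) ⊓ (k ∸ x)) (m≥n⇒m⊓n≡n x≤k))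
  (m≤n⇒m⊓n≡m (≤-trans (∸-monoˡ-≤ (d + x) h) (≤-reflexive ([m+n]∸[m+o]≡n∸o d k x))))
... | inj₂ k≤x = trans (cong ((k′ ∸ (d + (k ⊓ x))) ⊓_) (m≤n⇒m∸n≡0 k≤x))
  (trans (⊓-zeroʳ (k′ ∸ (d + (k ⊓ x)))) (sym (m≤n⇒m∸n≡0 (≤-trans h (+-monoʳ-≤ d k≤x)))))

-- `x` is the limit measured from the start of the window, so `k ⊓ x` of its cells are allowed and
-- `k ∸ x` forbidden.
completions-limit : ∀ {W H p k} {ws : Vec Window H} → Descending (p , k) ws → p + k ≤ W → ∀ v x → p + x ≤ W →
  Limits.completions (masks W ws) (p + x) v ≡ intervalCount p ws v (k ⊓ x) (k ∸ x)
completions-limit []    b []      x l = refl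
completions-limit {W} {p = p} {k} (_∷_ {w′ = p′ , k′} {ws = ws} (h₁ , h₂) d) b (n ∷ v) x l =
  trans (cong (λ l → Limits.completions (masks W ((p′ , k′) ∷ ws)) l (n ∷ v)) shift)
  (trans (step n) (sym (cong₂ (addIntervalRow n ψ) (⊓-absorbs e x k′≤) (∸-absorbs e x k′≤))))
  where
  e = p ∸ p′
  x′ = e + x
  ψ = intervalCount p′ ws v
  f : ℕ → ℕ
  f l = Limits.completions (masks W ws) l v
  b′ : p′ + k′ ≤ W
  b′ = ≤-trans h₂ b
  shift : p + x ≡ p′ + x′
  shift = trans (cong (_+ x) (sym (m+[n∸m]≡n h₁))) (+-assoc p′ e x)
  k′≤ : k′ ≤ e + k
  k′≤ = +-cancelˡ-≤ p′ k′ (e + k)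
    (≤-trans h₂ (≤-reflexive (trans (cong (_+ k) (sym (m+[n∸m]≡n h₁))) (+-assoc p′ e k))))
  l′ : p′ + x′ ≤ W
  l′ = subst (_≤ W) shift l
  step : ∀ n → Limits.completions (masks W ((p′ , k′) ∷ ws)) (p′ + x′) (n ∷ v) ≡
               addIntervalRow n ψ (k′ ⊓ x′) (k′ ∸ x′)
  step zero    = trans (sum-limitRow-empty (interval p′ k′ W) (p′ + x′) l′ f)
                       (completions-limit d b′ v x′ l′)
  step (suc n) = trans (sum-limitRow-nonempty p′ k′ x′ n f b′) (positions (k′ ⊓ x′) (k′ ∸ x′) total)
    where
    total : k′ ⊓ x′ + (k′ ∸ x′) ≡ k′
    total = trans (cong (_+ (k′ ∸ x′)) (⊓-comm k′ x′)) (m⊓n+n∸m≡n x′ k′)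
    positions : ∀ a j → a + j ≡ k′ → minimumSum n a (f ∘ (p′ +_)) ≡ addIntervalRow (suc n) ψ a j
    positions zero    j t = refl
    positions (suc a) j t = trans (minimumSum-stair n a j (f ∘ (p′ +_)))
      -- On the diagonal, allowed and forbidden cells together fill the window, and there the
      -- induction hypothesis expresses `ψ` by the new limit.
      (stair-onDiagonal n a j λ i i′ s → at i i′ (trans (cong suc s) t))
      where
      at : ∀ i i′ → suc (i + i′) ≡ k′ → f (p′ + suc i) ≡ ψ (suc i) i′
      at i i′ s = trans (completions-limit d b′ v (suc i) (≤-trans (+-monoʳ-≤ p′ si≤k′) b′))
        (cong₂ ψ (m≥n⇒m⊓n≡n si≤k′) (trans (cong (_∸ suc i) (sym s)) (m+n∸m≡n i i′)))
        where
        si≤k′ : suc i ≤ k′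
        si≤k′ = ≤-trans (m≤m+n (suc i) i′) (≤-reflexive s)

-- The start `(W , 0)` is an empty window behind the last column, so every column enters later as a
-- new one, blank in the word and allowed in the chain. From there `count-tracks` compares the two
-- counts.
completions-agree : ∀ {W H} {ws : Vec Window H} → Descending (W , 0) ws → ∀ v →
  Limits.completions (masks W ws) W v ≡ Words.completions (masks W ws) (Vec.replicate W ◇) v
completions-agree {W} {ws = ws} d v =
  trans (cong (λ l → Limits.completions (masks W ws) l v) (sym (+-identityʳ W)))
  (trans (completions-limit d (≤-reflexive (+-identityʳ W)) v 0 (≤-reflexive (+-identityʳ W)))
  (sym (trans (completions-word d v (Vec.replicate W ◇) (blank W)) (Tracks.unmarked (count-tracks W ws v) 0))))
  where
  blank : ∀ W → take W (toList (Vec.replicate W ◇)) ≡ run W 0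
  blank zero    = refl
  blank (suc W) = cong (◇ ∷_) (blank W)

-- Accepted matrices

∧-true : ∀ {a b} → a ≡ true → b ≡ true → a ∧ b ≡ true
∧-true refl refl = refl

occupied-update : ∀ b x more c → occupied (update b x more c) ≡ x ∨ occupied c
occupied-update false false more  c = refl
occupied-update true  false false c = refl
occupied-update true  false true  c = occupied-kill c
occupied-update false true  more  c = occupied-mark c
  where
  occupied-mark : ∀ c → occupied (mark c) ≡ true
  occupied-mark ○ = refl
  occupied-mark ◇ = refl
  occupied-mark ● = refl
  occupied-mark ◆ = refl
occupied-update true  true  false c = occupied-update false true true c
occupied-update true  true  true  c = trans (occupied-kill (mark c)) (occupied-update false true true c)

rowClear-kill : ∀ c → rowClear (kill c) ≡ false
rowClear-kill ○ = refl
rowClear-kill ◇ = refl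
rowClear-kill ● = refl
rowClear-kill ◆ = refl

rowClear-mark : ∀ c → rowClear (mark c) ≡ rowClear c
rowClear-mark ○ = refl
rowClear-mark ◇ = refl
rowClear-mark ● = refl
rowClear-mark ◆ = refl

rowClear-update : ∀ b x more c → rowClear (update b x more c) ≡ rowClear c ∧ not (b ∧ more)
rowClear-update true  true  true  c = trans (rowClear-kill (mark c)) (sym (∧-zeroʳ (rowClear c)))
rowClear-update true  false true  c = trans (rowClear-kill c) (sym (∧-zeroʳ (rowClear c)))
rowClear-update true  true  false c = trans (rowClear-mark c) (sym (∧-identityʳ (rowClear c)))
rowClear-update true  false false c = sym (∧-identityʳ (rowClear c))
rowClear-update false true  more  c = trans (rowClear-mark c) (sym (∧-identityʳ (rowClear c)))
rowClear-update false false more  c = sym (∧-identityʳ (rowClear c))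

empty⇒ : ∀ {W} (X : Row W) → (0 <ᵇ ∣ X ∣) ≡ false → ∀ i → lookup X i ≡ false
empty⇒ (false ∷ X) e zero    = refl
empty⇒ (false ∷ X) e (suc i) = empty⇒ X e i
empty⇒ (true  ∷ X) () _

empty⇐ : ∀ {W} (X : Row W) → (∀ i → lookup X i ≡ false) → (0 <ᵇ ∣ X ∣) ≡ false
empty⇐ []          e = refl
empty⇐ (false ∷ X) e = empty⇐ X (e ∘ suc)
empty⇐ (true  ∷ X) e with () ← e zero

vacant⇒ : ∀ {W} (m : Row W) u → vacant (select m u) ≡ true → ∀ i → lookup m i ≡ true → occupied (lookup u i) ≡ false
vacant⇒ (false ∷ m) (c ∷ u) e (suc i) p = vacant⇒ m u e i p
vacant⇒ (true  ∷ m) (c ∷ u) e (suc i) p = vacant⇒ m u (∧-conicalʳ (not (occupied c)) _ e) i p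
vacant⇒ (true  ∷ m) (c ∷ u) e zero    p with occupied c
... | false = refl
... | true  with () ← e

vacant⇐ : ∀ {W} (m : Row W) u → (∀ i → lookup m i ≡ true → occupied (lookup u i) ≡ false) → vacant (select m u) ≡ true
vacant⇐ []          []      h = refl
vacant⇐ (false ∷ m) (c ∷ u) h = vacant⇐ m u (h ∘ suc)
vacant⇐ (true  ∷ m) (c ∷ u) h rewrite h zero refl = vacant⇐ m u (h ∘ suc)

Free : ∀ {W} → Row W → Vec Letter W → Fin W → Set
Free m u i = rowClear (lookup u i) ≡ true ⊎ (∀ i′ → i Fin.< i′ → lookup m i′ ≡ true → occupied (lookup u i′) ≡ false)

okWord⇒ : ∀ {W} (m : Row W) u X → okWord m u X ≡ true →
          ∀ i → lookup X i ≡ true → lookup m i ≡ true × Free m u i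
okWord⇒ (b ∷ m) (c ∷ u) (true ∷ X) e zero p =
  ∧-conicalˡ b _ e₁ , ∨-elim (rowClear c) (∧-conicalʳ b _ e₁)
  where
  e₁ = ∧-conicalˡ (b ∧ free c (select m u)) _ e
  ∨-elim : ∀ a → a ∨ vacant (select m u) ≡ true →
           a ≡ true ⊎ (∀ i′ → 0 < toℕ i′ → lookup (b ∷ m) i′ ≡ true → occupied (lookup (c ∷ u) i′) ≡ false)
  ∨-elim true  e = inj₁ refl
  ∨-elim false e = inj₂ λ { (suc i′) _ → vacant⇒ m u e i′ }
okWord⇒ (b ∷ m) (c ∷ u) (x ∷ X) e (suc i) p with okWord⇒ m u X (∧-conicalʳ (not x ∨ (b ∧ _)) _ e) i p
... | inside , f = inside , map₂ (λ { h (suc i′) (s≤s lt) → h i′ lt }) f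

okWord⇐ : ∀ {W} (m : Row W) u X → (∀ i → lookup X i ≡ true → lookup m i ≡ true × Free m u i) →
          okWord m u X ≡ true
okWord⇐ []      []      []      h = refl
okWord⇐ (b ∷ m) (c ∷ u) (x ∷ X) h = ∧-true (head x (h zero))
  (okWord⇐ m u X λ i p → proj₁ (h (suc i) p) , map₂ (λ g i′ lt → g (suc i′) (s≤s lt)) (proj₂ (h (suc i) p)))
  where
  head : ∀ x → (x ≡ true → b ≡ true × Free (b ∷ m) (c ∷ u) zero) → (not x ∨ (b ∧ free c (select m u))) ≡ true
  head false h = refl
  head true  h with h refl
  ... | refl , inj₁ e rewrite e = refl
  ... | refl , inj₂ g = trans (cong (rowClear c ∨_) (vacant⇐ m u λ i → g (suc i) (s≤s z≤n))) (∨-zeroʳ (rowClear c))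

occupied-next : ∀ {W} (m : Row W) u X i → occupied (lookup (nextWord m u X) i) ≡ lookup X i ∨ occupied (lookup u i)
occupied-next (b ∷ m) (c ∷ u) (x ∷ X) zero    = occupied-update b x (0 <ᵇ ∣ X ∣) c
occupied-next (b ∷ m) (c ∷ u) (x ∷ X) (suc i) = occupied-next m u X i

rowClear-next⇒ : ∀ {W} (m : Row W) u X i → rowClear (lookup (nextWord m u X) i) ≡ true →
  rowClear (lookup u i) ≡ true × (lookup m i ≡ true → ∀ i′ → i Fin.< i′ → lookup X i′ ≡ false)
rowClear-next⇒ (b ∷ m) (c ∷ u) (x ∷ X) (suc i) e with rowClear-next⇒ m u X i e
... | e₁ , h = e₁ , λ { p (suc i′) (s≤s lt) → h p i′ lt }
rowClear-next⇒ (b ∷ m) (c ∷ u) (x ∷ X) zero e =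
  ∧-conicalˡ (rowClear c) _ e′ , λ { p (suc i′) _ → empty⇒ X (not-true (0 <ᵇ ∣ X ∣)
    (subst (λ b → not (b ∧ (0 <ᵇ ∣ X ∣)) ≡ true) p (∧-conicalʳ (rowClear c) _ e′))) i′ }
  where
  e′ = trans (sym (rowClear-update b x (0 <ᵇ ∣ X ∣) c)) e
  not-true : ∀ a → not a ≡ true → a ≡ false
  not-true false _ = refl

rowClear-next⇐ : ∀ {W} (m : Row W) u X i → rowClear (lookup u i) ≡ true →
  (lookup m i ≡ true → ∀ i′ → i Fin.< i′ → lookup X i′ ≡ false) → rowClear (lookup (nextWord m u X) i) ≡ true
rowClear-next⇐ (b ∷ m) (c ∷ u) (x ∷ X) (suc i) e h = rowClear-next⇐ m u X i e λ p i′ lt → h p (suc i′) (s≤s lt)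
rowClear-next⇐ (b ∷ m) (c ∷ u) (x ∷ X) zero    e h = trans (rowClear-update b x (0 <ᵇ ∣ X ∣) c) (∧-true e (alive b h))
  where
  alive : ∀ b → (b ≡ true → ∀ i′ → 0 < toℕ i′ → lookup (x ∷ X) i′ ≡ false) → not (b ∧ (0 <ᵇ ∣ X ∣)) ≡ true
  alive false h = refl
  alive true  h = cong not (empty⇐ X λ i → h refl (suc i) (s≤s z≤n))

cell : ∀ {W H} → Vec (Row W) H → Fin H → Fin W → Bool
cell Xs t i = lookup (lookup Xs t) i

-- Rows are listed from top to bottom: t′ < t says that row t′ lies above row t.
RowGood ColGood : ∀ {W H} → Vec (Row W) H → Vec (Row W) H → Fin H → Fin W → Set
RowGood ms Xs t i = ∀ t′ → t′ Fin.< t → cell ms t′ i ≡ true → ∀ i′ → i Fin.< i′ → cell Xs t′ i′ ≡ false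
ColGood ms Xs t i = ∀ i′ → i Fin.< i′ → cell ms t i′ ≡ true → ∀ t′ → t′ Fin.< t → cell Xs t′ i′ ≡ false

-- The state `u` summarises rows above those listed, as the induction over rows requires. For the
-- all-◇ state what remains is `RowGood` or `ColGood` at every 1-cell.
GoodAbove : ∀ {W H} → Vec (Row W) H → Vec Letter W → Vec (Row W) H → Set
GoodAbove ms u Xs = ∀ t i → cell Xs t i ≡ true → cell ms t i ≡ true ×
  ((rowClear (lookup u i) ≡ true × RowGood ms Xs t i) ⊎
   ((∀ i′ → i Fin.< i′ → cell ms t i′ ≡ true → occupied (lookup u i′) ≡ false) × ColGood ms Xs t i))

∨-falseˡ : ∀ {a b} → a ∨ b ≡ false → a ≡ false
∨-falseˡ {false} e = refl

∨-falseʳ : ∀ {a b} → a ∨ b ≡ false → b ≡ false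
∨-falseʳ {false} e = e

∨-false : ∀ {a b} → a ≡ false → b ≡ false → a ∨ b ≡ false
∨-false refl refl = refl

acceptWord⇒ : ∀ {W H} (ms : Vec (Row W) H) u Xs → Words.accept ms u Xs ≡ true → GoodAbove ms u Xs
acceptWord⇒ (m ∷ ms) u (X ∷ Xs) e zero i p with okWord⇒ m u X (∧-conicalˡ (okWord m u X) _ e) i p
... | inside , inj₁ f = inside , inj₁ (f , λ _ ())
... | inside , inj₂ g = inside , inj₂ (g , λ _ _ _ _ ())
acceptWord⇒ (m ∷ ms) u (X ∷ Xs) e (suc t) i p
  with acceptWord⇒ ms (nextWord m u X) Xs (∧-conicalʳ (okWord m u X) _ e) t i p
... | inside , inj₁ (f , rg) with rowClear-next⇒ m u X i f
...   | f′ , h = inside , inj₁ (f′ , λ { zero _ → h ; (suc t′) (s≤s lt) → rg t′ lt })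
acceptWord⇒ (m ∷ ms) u (X ∷ Xs) e (suc t) i p
    | inside , inj₂ (f , cg) = inside , inj₂
  ( (λ i′ lt b → ∨-falseʳ {lookup X i′} (old i′ lt b))
  , λ { i′ lt b zero _ → ∨-falseˡ (old i′ lt b) ; i′ lt b (suc t′) (s≤s lt′) → cg i′ lt b t′ lt′ })
  where
  old : ∀ i′ → i Fin.< i′ → cell ms t i′ ≡ true → lookup X i′ ∨ occupied (lookup u i′) ≡ false
  old i′ lt b = trans (sym (occupied-next m u X i′)) (f i′ lt b)

acceptWord⇐ : ∀ {W H} (ms : Vec (Row W) H) u Xs → GoodAbove ms u Xs → Words.accept ms u Xs ≡ true
acceptWord⇐ []       u []       h = refl
acceptWord⇐ (m ∷ ms) u (X ∷ Xs) h = ∧-true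
  (okWord⇐ m u X λ i p → proj₁ (h zero i p) , [ inj₁ ∘ proj₁ , inj₂ ∘ proj₁ ]′ (proj₂ (h zero i p)))
  (acceptWord⇐ ms (nextWord m u X) Xs λ t i p → proj₁ (h (suc t) i p) , later t i (proj₂ (h (suc t) i p)))
  where
  later : ∀ t i → _ → _
  later t i (inj₁ (f , rg)) = inj₁
    (rowClear-next⇐ m u X i f (rg zero (s≤s z≤n)) , λ t′ lt → rg (suc t′) (s≤s lt))
  later t i (inj₂ (f , cg)) = inj₂
    ( (λ i′ lt b → trans (occupied-next m u X i′) (∨-false (cg i′ lt b zero (s≤s z≤n)) (f i′ lt b)))
    , λ i′ lt b t′ lt′ → cg i′ lt b (suc t′) (s≤s lt′))

okLimit⇒ : ∀ {W} (m : Row W) l X → okLimit m l X ≡ true →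
           ∀ i → lookup X i ≡ true → lookup m i ≡ true × toℕ i < l
okLimit⇒ (b ∷ m) l (true ∷ X) e zero p = ∧-conicalˡ b _ e₁ , positive l (∧-conicalʳ b _ e₁)
  where
  e₁ = ∧-conicalˡ (b ∧ (0 <ᵇ l)) _ e
  positive : ∀ l → (0 <ᵇ l) ≡ true → 0 < l
  positive (suc l) _ = s≤s z≤n
okLimit⇒ (b ∷ m) l (x ∷ X) e (suc i) p with okLimit⇒ m (pred l) X (∧-conicalʳ (not x ∨ (b ∧ _)) _ e) i p
... | inside , lt = inside , <pred⇒suc< l lt
  where
  <pred⇒suc< : ∀ l {n} → n < pred l → suc n < l
  <pred⇒suc< (suc l) = s≤s

okLimit⇐ : ∀ {W} (m : Row W) l X → (∀ i → lookup X i ≡ true → lookup m i ≡ true × toℕ i < l) →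
           okLimit m l X ≡ true
okLimit⇐ []      l []      h = refl
okLimit⇐ (b ∷ m) l (x ∷ X) h = ∧-true (head x l (h zero))
  (okLimit⇐ m (pred l) X λ i p → proj₁ (h (suc i) p) , ℕₚ.pred-mono-≤ (proj₂ (h (suc i) p)))
  where
  head : ∀ x l → (x ≡ true → b ≡ true × 0 < l) → (not x ∨ (b ∧ (0 <ᵇ l))) ≡ true
  head false l h = refl
  head true  l h with h refl
  head true (suc l) h | refl , s≤s _ = refl

<firstPosition⇒ : ∀ {W} (X : Row W) (i : Fin W) → toℕ i < firstPosition X → ∀ i′ → lookup X i′ ≡ true → i Fin.≤ i′
<firstPosition⇒ X           zero    lt       i′       p = z≤n
<firstPosition⇒ (true ∷ X)  (suc i) (s≤s ()) i′       p
<firstPosition⇒ (false ∷ X) (suc i) (s≤s lt) (suc i′) p = s≤s (<firstPosition⇒ X i lt i′ p)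

<firstPosition⇐ : ∀ {W} (X : Row W) (i : Fin W) → (∀ i′ → lookup X i′ ≡ true → i Fin.≤ i′) → toℕ i < firstPosition X
<firstPosition⇐ (true  ∷ X) zero    h = s≤s z≤n
<firstPosition⇐ (false ∷ X) zero    h = s≤s z≤n
<firstPosition⇐ (true  ∷ X) (suc i) h with () ← h zero refl
<firstPosition⇐ (false ∷ X) (suc i) h = s≤s (<firstPosition⇐ X i λ i′ p → ℕₚ.≤-pred (h (suc i′) p))

LeftOfAbove : ∀ {W H} → Vec (Row W) H → ℕ → Vec (Row W) H → Set
LeftOfAbove ms l Xs = ∀ t i → cell Xs t i ≡ true → cell ms t i ≡ true × toℕ i < l ×
  (∀ t′ → t′ Fin.< t → ∀ i′ → cell Xs t′ i′ ≡ true → i Fin.≤ i′)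

acceptLimit⇒ : ∀ {W H} (ms : Vec (Row W) H) l Xs → Limits.accept ms l Xs ≡ true → LeftOfAbove ms l Xs
acceptLimit⇒ (m ∷ ms) l (X ∷ Xs) e zero i p with okLimit⇒ m l X (∧-conicalˡ (okLimit m l X) _ e) i p
... | inside , lt = inside , lt , λ _ ()
acceptLimit⇒ (m ∷ ms) l (X ∷ Xs) e (suc t) i p
  with acceptLimit⇒ ms (nextLimit m l X) Xs (∧-conicalʳ (okLimit m l X) _ e) t i p
... | inside , lt , h = inside , m<n⊓o⇒m<n l _ lt ,
  λ { zero _ → <firstPosition⇒ X i (m<n⊓o⇒m<o l _ lt) ; (suc t′) (s≤s lt′) → h t′ lt′ }

acceptLimit⇐ : ∀ {W H} (ms : Vec (Row W) H) l Xs → LeftOfAbove ms l Xs → Limits.accept ms l Xs ≡ true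
acceptLimit⇐ []       l []       h = refl
acceptLimit⇐ (m ∷ ms) l (X ∷ Xs) h = ∧-true
  (okLimit⇐ m l X λ i p → proj₁ (h zero i p) , proj₁ (proj₂ (h zero i p)))
  (acceptLimit⇐ ms (nextLimit m l X) Xs λ t i p → let inside , lt , g = h (suc t) i p in
    inside , ⊓-glb lt (<firstPosition⇐ X i (g zero (s≤s z≤n))) , λ t′ lt′ → g (suc t′) (s≤s lt′))

-- Skew shapes as sequences of windows

-- From a cell of `F`, first move up its column, which reaches the top row, then left along the row,
-- which reaches the first column.
ferrers-fill : ∀ {i₀ j₀ F} → NWFerrers (i₀ , j₀) F → ∀ {i j x y} → (i , j) ∈ F →
               i₀ ℤ.≤ x → x ℤ.≤ i → j ℤ.≤ y → y ℤ.≤ j₀ → (x , y) ∈ F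
ferrers-fill F c l r b t =
  rowsContiguous (proj₁ (leftJustified d)) d l r
  where
  open NWFerrers F
  d = colsContiguous c (proj₁ (topJustified c)) b t

Convex : Shape → Set
Convex S = ∀ {i i′ x j j′ y} → T (has S i j) → T (has S i′ j′) →
           i Fin.≤ x → x Fin.≤ i′ → j′ Fin.≤ y → y Fin.≤ j → T (has S x y)

-- The rectangle between a NW and a SE cell lies in `F₁` because its SE corner does; a cell of it in
-- `F₂` would force the NW corner into `F₂`.
skew⇒convex : ∀ {S} → IsSkew S → Convex S
skew⇒convex {S} sk {i} {i′} {x} {j} {j′} {y} c c′ l r b t
  with proj₁ difference (i , j , c , refl) | proj₁ difference (i′ , j′ , c′ , refl)
  where open IsSkew sk
... | c∈F₁ , c∉F₂ | c′∈F₁ , _ with proj₂ difference (inside , outside)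
  where
  open IsSkew sk
  module F = NWFerrers F₁-ferrers
  le : ∀ {m n} {a : Fin m} {b : Fin n} → toℕ a ≤ toℕ b → ℤ.+ suc (toℕ a) ℤ.≤ ℤ.+ suc (toℕ b)
  le p = +≤+ (s≤s p)
  inside = ferrers-fill F₁-ferrers c′∈F₁ (ℤₚ.≤-trans (proj₂ (F.leftJustified c∈F₁)) (le l)) (le r) (le b)
             (ℤₚ.≤-trans (le t) (proj₂ (F.topJustified c∈F₁)))
  outside : ¬ ((ℤ.+ suc (toℕ x) , ℤ.+ suc (toℕ y)) ∈ F₂)
  outside p with F₂-ferrers
  ... | inj₁ F₂≡[] with () ← subst (_ ∈_) F₂≡[] p
  ... | inj₂ F₂-nw = c∉F₂ (ferrers-fill F₂-nw p (proj₂ (F.leftJustified c∈F₁)) (le l) (le t)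
                             (proj₂ (F.topJustified c∈F₁)))
... | x′ , y′ , c″ , eq rewrite toℕ-injective (ℤₚ.+[1+-injective (cong proj₁ eq))
                              | toℕ-injective (ℤₚ.+[1+-injective (cong proj₂ eq)) = c″

threshold : ∀ {n} {P : Fin n → Set} → Decidable P → ℕ
threshold {zero}  P? = 0
threshold {suc n} P? with P? zero
... | yes _ = 0
... | no  _ = suc (threshold (P? ∘ suc))

UpwardClosed : ∀ {n} → (Fin n → Set) → Set
UpwardClosed P = ∀ {i i′} → i Fin.≤ i′ → P i → P i′

threshold⇒ : ∀ {n} {P : Fin n → Set} (P? : Decidable P) → UpwardClosed P → ∀ {i} → threshold P? ≤ toℕ i → P i
threshold⇒ {suc n} P? up {i} le with P? zero
threshold⇒ {suc n} P? up {i}     le       | yes p = up z≤n p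
threshold⇒ {suc n} P? up {suc i} (s≤s le) | no  _ = threshold⇒ (P? ∘ suc) (up ∘ s≤s) le

threshold⇐ : ∀ {n} {P : Fin n → Set} (P? : Decidable P) → ∀ {i} → P i → threshold P? ≤ toℕ i
threshold⇐ {suc n} P? {i} p with P? zero
threshold⇐ {suc n} P? {i}     p | yes _ = z≤n
threshold⇐ {suc n} P? {zero}  p | no ¬p = contradiction p ¬p
threshold⇐ {suc n} P? {suc i} p | no _  = s≤s (threshold⇐ (P? ∘ suc) p)

threshold≤ : ∀ {n} {P : Fin n → Set} (P? : Decidable P) → threshold P? ≤ n
threshold≤ {zero}  P? = z≤n
threshold≤ {suc n} P? with P? zero
... | yes _ = z≤n
... | no  _ = s≤s (threshold≤ (P? ∘ suc))

threshold-mono : ∀ {n} {P Q : Fin n → Set} (P? : Decidable P) (Q? : Decidable Q) →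
                 (∀ {i} → P i → Q i) → threshold Q? ≤ threshold P?
threshold-mono {zero}  P? Q? f = z≤n
threshold-mono {suc n} P? Q? f with P? zero | Q? zero
... | yes p | yes _ = z≤n
... | yes p | no ¬q = contradiction (f p) ¬q
... | no _  | yes _ = z≤n
... | no _  | no _  = s≤s (threshold-mono (P? ∘ suc) (Q? ∘ suc) f)

lookup-interval⇒ : ∀ p k {W} (i : Fin W) → lookup (interval p k W) i ≡ true → p ≤ toℕ i × toℕ i < p + k
lookup-interval⇒ (suc p) k       (suc i) e with lookup-interval⇒ p k i e
... | l , r = s≤s l , s≤s r
lookup-interval⇒ zero    (suc k) zero    e = z≤n , s≤s z≤n
lookup-interval⇒ zero    (suc k) (suc i) e = z≤n , s≤s (proj₂ (lookup-interval⇒ zero k i e))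
lookup-interval⇒ zero    zero    (suc i) e with () ← proj₂ (lookup-interval⇒ zero zero i e)

lookup-interval⇐ : ∀ p k {W} (i : Fin W) → p ≤ toℕ i → toℕ i < p + k → lookup (interval p k W) i ≡ true
lookup-interval⇐ (suc p) k       (suc i) (s≤s l) (s≤s r) = lookup-interval⇐ p k i l r
lookup-interval⇐ zero    (suc k) zero    l       r       = refl
lookup-interval⇐ zero    (suc k) (suc i) l       (s≤s r) = lookup-interval⇐ zero k i z≤n r

m+[n∸m]≡m⊔n : ∀ m n → m + (n ∸ m) ≡ m ⊔ n
m+[n∸m]≡m⊔n zero    n       = refl
m+[n∸m]≡m⊔n (suc m) zero    = cong suc (+-identityʳ m)
m+[n∸m]≡m⊔n (suc m) (suc n) = cong suc (m+[n∸m]≡m⊔n m n)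

tabulate-descending : ∀ {H pk} (f : Fin H → Window) → (∀ t → f t ≼ pk) →
                      (∀ {t t′} → t Fin.< t′ → f t′ ≼ f t) → Descending pk (tabulate f)
tabulate-descending {zero}  f h d = []
tabulate-descending {suc H} f h d = h zero ∷ tabulate-descending (f ∘ suc) (λ t → d (s≤s z≤n)) (d ∘ s≤s)

opposite-< : ∀ {n} {t t′ : Fin n} → t Fin.< t′ → opposite t′ Fin.< opposite t
opposite-< {n} {t} {t′} lt rewrite opposite-prop t | opposite-prop t′ = ∸-monoʳ-< (s≤s lt) (toℕ<n t′)

module Windows (S : Shape) (convex : Convex S) where

  -- An empty row gets the window forced by the rows above and below it, which keeps the windows
  -- monotone.
  ReachedFromLeft ReachedFromRight : Fin (height S) → Fin (width S) → Set
  ReachedFromLeft  j i = ∃ λ j′ → j Fin.≤ j′ × ∃ λ i′ → i′ Fin.≤ i × T (has S i′ j′)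
  ReachedFromRight j i = ∃ λ j′ → j′ Fin.≤ j × ∃ λ i′ → i Fin.≤ i′ × T (has S i′ j′)

  reachedFromLeft? : ∀ j → Decidable (ReachedFromLeft j)
  reachedFromLeft? j i = any? λ j′ → (j Finₚ.≤? j′) ×-dec any? λ i′ → (i′ Finₚ.≤? i) ×-dec T? (has S i′ j′)

  beyond? : ∀ j → Decidable (λ i → ¬ ReachedFromRight j i)
  beyond? j i = ¬? (any? λ j′ → (j′ Finₚ.≤? j) ×-dec any? λ i′ → (i Finₚ.≤? i′) ×-dec T? (has S i′ j′))

  reached⇒has : ∀ {i j} → ReachedFromLeft j i → ReachedFromRight j i → T (has S i j)
  reached⇒has (_ , t , _ , l , c) (_ , b , _ , r , c′) = convex c c′ l r b t

  left right : Fin (height S) → ℕ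
  left  j = threshold (reachedFromLeft? j)
  right j = threshold (beyond? j)

  window : Fin (height S) → Window
  window j = left j , right j ∸ left j

  -- In an empty row `right j` may lie before `left j`; truncated subtraction then gives length 0.
  -- The end is a maximum of two monotone bounds, hence monotone.
  window-end : ∀ j → left j + (right j ∸ left j) ≡ left j ⊔ right j
  window-end j = m+[n∸m]≡m⊔n (left j) (right j)

  window-mono : ∀ {j j′} → j Fin.≤ j′ → window j ≼ window j′
  window-mono {j} {j′} le = left≤ , (begin
    left j  + (right j  ∸ left j)  ≡⟨ window-end j ⟩
    left j  ⊔ right j              ≤⟨ ⊔-mono-≤ left≤ right≤ ⟩
    left j′ ⊔ right j′             ≡⟨ sym (window-end j′) ⟩
    left j′ + (right j′ ∸ left j′) ∎)
    where
    open ≤-Reasoning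
    left≤ : left j ≤ left j′
    left≤ = threshold-mono (reachedFromLeft? j′) (reachedFromLeft? j)
              λ (j″ , l , r) → j″ , ≤-trans le l , r
    right≤ : right j ≤ right j′
    right≤ = threshold-mono (beyond? j′) (beyond? j)
               λ ¬b (j″ , l , r) → ¬b (j″ , ≤-trans l le , r)

  window-bounded : ∀ j → window j ≼ (width S , 0)
  window-bounded j = threshold≤ (reachedFromLeft? j) , (begin
    left j + (right j ∸ left j) ≡⟨ window-end j ⟩
    left j ⊔ right j            ≤⟨ ⊔-lub (threshold≤ (reachedFromLeft? j)) (threshold≤ (beyond? j)) ⟩
    width S                     ≡⟨ sym (+-identityʳ (width S)) ⟩
    width S + 0                 ∎)
    where open ≤-Reasoning

  mask⇒has : ∀ i j → lookup (mask (width S) (window j)) i ≡ true → T (has S i j)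
  mask⇒has i j e with lookup-interval⇒ (left j) (right j ∸ left j) i e
  ... | l , r with T? (has S i j)
  ...   | yes c = c
  -- A position from `left j` on is reached from the left. Outside `S` it cannot also be reached
  -- from the right, so it would lie beyond the end of the window.
  ...   | no ¬c = contradiction (<-≤-trans (<-≤-trans r (≤-reflexive (window-end j))) (⊔-lub l right≤i)) (<-irrefl refl)
    where
    reached = threshold⇒ (reachedFromLeft? j)
      (λ le (j′ , t , i′ , l′ , c) → j′ , t , i′ , ≤-trans l′ le , c) l
    right≤i : right j ≤ toℕ i
    right≤i = threshold⇐ (beyond? j) λ b → ¬c (reached⇒has reached b)

  has⇒mask : ∀ i j → T (has S i j) → lookup (mask (width S) (window j)) i ≡ true
  has⇒mask i j c = lookup-interval⇐ (left j) (right j ∸ left j) i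
    (threshold⇐ (reachedFromLeft? j) (j , ≤-refl , i , ≤-refl , c))
    (<-≤-trans (≰⇒> ¬right≤i) (≤-trans (m≤n⊔m (left j) (right j)) (≤-reflexive (sym (window-end j)))))
    where
    ¬right≤i : ¬ (right j ≤ toℕ i)
    ¬right≤i le = threshold⇒ (beyond? j)
      (λ le′ ¬b (j′ , t , i′ , l′ , c) → ¬b (j′ , t , i′ , ≤-trans le′ l′ , c)) le
      (j , ≤-refl , i , ≤-refl , c)

  windows : Vec Window (height S)
  windows = tabulate (window ∘ opposite)

  windows-descending : Descending (width S , 0) windows
  windows-descending = tabulate-descending (window ∘ opposite) (window-bounded ∘ opposite)
    (λ lt → window-mono (<⇒≤ (opposite-< lt)))

  shapeRows : Vec (Row (width S)) (height S)
  shapeRows = masks (width S) windows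

  shapeRows-cell : ∀ t i → cell shapeRows t i ≡ lookup (mask (width S) (window (opposite t))) i
  shapeRows-cell t i = cong (λ m → lookup m i)
    (trans (lookup-map t (mask (width S)) windows) (cong (mask (width S)) (lookup∘tabulate (window ∘ opposite) t)))

  cell⇒has : ∀ t i → cell shapeRows t i ≡ true → T (has S i (opposite t))
  cell⇒has t i e = mask⇒has i (opposite t) (trans (sym (shapeRows-cell t i)) e)

  has⇒cell : ∀ t i → T (has S i (opposite t)) → cell shapeRows t i ≡ true
  has⇒cell t i c = trans (shapeRows-cell t i) (has⇒mask i (opposite t) c)

-- Avoidance

One : ∀ {S} → Filling S → Fin (width S) → Fin (height S) → Set
One {S} φ i j = isOneCell {S} φ i j ≡ true

isOneCell-inside : ∀ {S} (φ : Filling S) {i j} .(c : T (has S i j)) → isOneCell {S} φ i j ≡ φ i j c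
isOneCell-inside {S} φ {i} {j} c with T? (has S i j)
... | yes _ = refl
... | no ¬c = contradiction-irr c ¬c

one⇒inside : ∀ {S} (φ : Filling S) {i j} → One {S} φ i j → T (has S i j)
one⇒inside {S} φ {i} {j} p with T? (has S i j)
... | yes c = c
one⇒inside {S} φ {i} {j} () | no _

module _ {S P : Shape} (φ : Filling S) (π : Filling P) where

  contains : (occ : Occurrence P S) → let open Occurrence occ in
             (∀ i j (c : T (has P i j)) → π i j c ≡ true → One {S} φ (col i) (row j)) → Contains {S} {P} φ π
  contains occ h = occ , λ i j c → below i j c (h i j c)
    where
    open Occurrence occ
    below : ∀ i j (c : T (has P i j)) → (π i j c ≡ true → One {S} φ (col i) (row j)) →
            π i j c Bool.≤ φ (col i) (row j) (subst T (matches i j) c)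
    below i j c g with π i j c
    ... | false = ≤-minimum _
    ... | true  = Boolₚ.≤-reflexive (trans (sym (g refl)) (isOneCell-inside {S} φ (subst T (matches i j) c)))

  contained-one : ((occ , _) : Contains {S} {P} φ π) → let open Occurrence occ in
                  ∀ i j (c : T (has P i j)) → π i j c ≡ true → One {S} φ (col i) (row j)
  contained-one (occ , h) i j c p =
    trans (isOneCell-inside {S} φ (subst T (matches i j) c)) (true≤ (subst (Bool._≤ _) p (h i j c)))
    where
    open Occurrence occ
    true≤ : ∀ {b} → true Bool.≤ b → b ≡ true
    true≤ b≤b = refl

increasing₂ : ∀ {n} {a b : Fin n} → a Fin.< b → ∀ {i i′ : Fin 2} → i Fin.< i′ →
              lookup (a ∷ b ∷ []) i Fin.< lookup (a ∷ b ∷ []) i′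
increasing₂ a<b {0F} {1F} _         = a<b
increasing₂ a<b {1F} {1F} (s≤s ())
increasing₂ a<b {1F} {0F} ()
increasing₂ a<b {0F} {0F} ()

increasing₃ : ∀ {n} {a b c : Fin n} → a Fin.< b → b Fin.< c → ∀ {i i′ : Fin 3} → i Fin.< i′ →
              lookup (a ∷ b ∷ c ∷ []) i Fin.< lookup (a ∷ b ∷ c ∷ []) i′
increasing₃ a<b b<c {0F} {1F} _ = a<b
increasing₃ a<b b<c {0F} {2F} _ = ℕₚ.<-trans a<b b<c
increasing₃ a<b b<c {1F} {2F} _ = b<c
increasing₃ a<b b<c {0F} {0F} ()
increasing₃ a<b b<c {1F} {0F} ()
increasing₃ a<b b<c {2F} {0F} ()
increasing₃ a<b b<c {1F} {1F} (s≤s ())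
increasing₃ a<b b<c {2F} {1F} (s≤s ())
increasing₃ a<b b<c {2F} {2F} (s≤s (s≤s ()))

has≡true : ∀ {b} → T b → true ≡ b
has≡true t = sym (Equivalence.to T-≡ t)

has≡false : ∀ {b} → ¬ T b → false ≡ b
has≡false {false} _ = refl
has≡false {true}  f with () ← f tt

module Avoidance (S : Shape) (convex : Convex S) where

  In : Fin (width S) → Fin (height S) → Set
  In i j = T (has S i j)

  -- The given corners are the NW and the SE one, so convexity supplies the other two.
  square : ∀ {i i′ j j′} → i Fin.< i′ → j Fin.< j′ → In i j′ → In i′ j → Occurrence □₂ S
  square {i} {i′} {j} {j′} i<i′ j<j′ tl br = record
    { row            = lookup (j ∷ j′ ∷ [])
    ; col            = lookup (i ∷ i′ ∷ [])
    ; row-increasing = increasing₂ j<j′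
    ; col-increasing = increasing₂ i<i′
    ; matches        = λ { 0F 0F → has≡true (between ℕₚ.≤-refl (ℕₚ.<⇒≤ i<i′) ℕₚ.≤-refl (ℕₚ.<⇒≤ j<j′))
                         ; 0F 1F → has≡true tl
                         ; 1F 0F → has≡true br
                         ; 1F 1F → has≡true (between (ℕₚ.<⇒≤ i<i′) ℕₚ.≤-refl (ℕₚ.<⇒≤ j<j′) ℕₚ.≤-refl) }
    }
    where
    between : ∀ {x y} → i Fin.≤ x → x Fin.≤ i′ → j Fin.≤ y → y Fin.≤ j′ → In x y
    between = convex tl br

  Chain : Filling S → Set
  Chain φ = ∀ {i i′ j j′} → One {S} φ i j → One {S} φ i′ j′ → j Fin.< j′ → i Fin.≤ i′

  avoidsδ⇒chain : ∀ φ → Avoids {S} {□₂} φ δ₂ → Chain φ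
  avoidsδ⇒chain φ av {i} {i′} {j} {j′} p p′ j<j′ with i Finₚ.≤? i′
  ... | yes le = le
  ... | no ¬le = contradiction (contains {S} {□₂} φ δ₂
      (square (ℕₚ.≰⇒> ¬le) j<j′ (one⇒inside {S} φ p′) (one⇒inside {S} φ p))
      λ { 0F 0F _ () ; 0F 1F _ _ → p′ ; 1F 0F _ _ → p ; 1F 1F _ () }) av

  chain⇒avoidsδ : ∀ φ → Chain φ → Avoids {S} {□₂} φ δ₂
  chain⇒avoidsδ φ ch occ@(o , _) = ℕₚ.<⇒≱ (col-increasing {0F} {1F} (s≤s z≤n))
    (ch (contained-one {S} {□₂} φ δ₂ occ 1F 0F tt refl) (contained-one {S} {□₂} φ δ₂ occ 0F 1F tt refl)
        (row-increasing {0F} {1F} (s≤s z≤n)))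
    where open Occurrence o

  RowBad ColBad : Filling S → Fin (width S) → Fin (height S) → Set
  RowBad φ i j = ∃₂ λ i′ j′ → i Fin.< i′ × j Fin.< j′ × In i j′ × One {S} φ i′ j′
  ColBad φ i j = ∃₂ λ i′ j′ → i Fin.< i′ × j Fin.< j′ × In i′ j × One {S} φ i′ j′

  Good : Filling S → Set
  Good φ = ∀ {i j} → One {S} φ i j → RowBad φ i j → ¬ ColBad φ i j

  -- In `ι₂` the upper 1-cell is both the row and the column witness against the lower one. In `φD`
  -- the 1-cell in the last column is the row witness and the one in the top row the column witness.
  good⇒avoids : ∀ φ → Good φ → Avoids {S} {□₂} φ ι₂ × Avoids {S} {D} φ φD
  good⇒avoids φ g = avoidsι , avoidsφD
    where
    avoidsι : Avoids {S} {□₂} φ ι₂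
    avoidsι occ@(o , _) = g (one 0F 0F tt refl)
      (_ , _ , col-increasing {0F} {1F} (s≤s z≤n) , row-increasing {0F} {1F} (s≤s z≤n) ,
       subst T (matches 0F 1F) tt , one 1F 1F tt refl)
      (_ , _ , col-increasing {0F} {1F} (s≤s z≤n) , row-increasing {0F} {1F} (s≤s z≤n) ,
       subst T (matches 1F 0F) tt , one 1F 1F tt refl)
      where
      open Occurrence o
      one = contained-one {S} {□₂} φ ι₂ occ
    avoidsφD : Avoids {S} {D} φ φD
    avoidsφD occ@(o , _) = g (one 0F 0F tt refl)
      (_ , _ , col-increasing {0F} {2F} (s≤s z≤n) , row-increasing {0F} {1F} (s≤s z≤n) ,
       subst T (matches 0F 1F) tt , one 2F 1F tt refl)
      (_ , _ , col-increasing {0F} {1F} (s≤s z≤n) , row-increasing {0F} {2F} (s≤s z≤n) ,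
       subst T (matches 1F 0F) tt , one 1F 2F tt refl)
      where
      open Occurrence o
      one = contained-one {S} {D} φ φD occ

  -- Let (i′, j′) be the row witness and (i″, j″) the column witness. If either spans a full square
  -- with (i, j), this is `ι₂`. Otherwise the missing corners force i″ < i′ and j′ < j″ by
  -- convexity, and the three rows and columns cut out `D`.
  avoids⇒good : ∀ φ → Avoids {S} {□₂} φ ι₂ → Avoids {S} {D} φ φD → Good φ
  avoids⇒good φ avι avD {i} {j} p (i′ , j′ , i<i′ , j<j′ , ij′ , p′) (i″ , j″ , i<i″ , j<j″ , i″j , p″)
    with T? (has S i′ j) | T? (has S i j″)
  ... | yes i′j | _ = avι (contains {S} {□₂} φ ι₂ (square i<i′ j<j′ ij′ i′j)
                        λ { 0F 0F _ _ → p ; 0F 1F _ () ; 1F 0F _ () ; 1F 1F _ _ → p′ })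
  ... | no _ | yes ij″ = avι (contains {S} {□₂} φ ι₂ (square i<i″ j<j″ ij″ i″j)
                        λ { 0F 0F _ _ → p ; 0F 1F _ () ; 1F 0F _ () ; 1F 1F _ _ → p″ })
  ... | no ¬i′j | no ¬ij″ = avD (contains {S} {D} φ φD staircase
                        λ { 0F 0F _ _ → p ; 1F 2F _ _ → p″ ; 2F 1F _ _ → p′
                          ; 0F 1F _ () ; 1F 0F _ () ; 1F 1F _ () ; 2F 2F _ () })
    where
    ij = one⇒inside {S} φ p
    j′<j″ : j′ Fin.< j″
    j′<j″ = ℕₚ.≰⇒> λ le → ¬ij″ (convex ij′ ij ℕₚ.≤-refl ℕₚ.≤-refl (ℕₚ.<⇒≤ j<j″) le)
    i″<i′ : i″ Fin.< i′
    i″<i′ = ℕₚ.≰⇒> λ le → ¬i′j (convex ij i″j (ℕₚ.<⇒≤ i<i′) le ℕₚ.≤-refl ℕₚ.≤-refl)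
    i″j′ = convex ij′ i″j (ℕₚ.<⇒≤ i<i″) ℕₚ.≤-refl (ℕₚ.<⇒≤ j<j′) ℕₚ.≤-refl
    i′j″ = convex (one⇒inside {S} φ p″) (one⇒inside {S} φ p′) (ℕₚ.<⇒≤ i″<i′) ℕₚ.≤-refl
             (ℕₚ.<⇒≤ j′<j″) ℕₚ.≤-refl
    staircase : Occurrence D S
    staircase = record
      { row            = lookup (j ∷ j′ ∷ j″ ∷ [])
      ; col            = lookup (i ∷ i″ ∷ i′ ∷ [])
      ; row-increasing = increasing₃ j<j′ j′<j″
      ; col-increasing = increasing₃ i<i″ i″<i′
      ; matches        = λ { 0F 0F → has≡true ij
                           ; 0F 1F → has≡true ij′
                           ; 0F 2F → has≡false ¬ij″
                           ; 1F 0F → has≡true i″j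
                           ; 1F 1F → has≡true i″j′
                           ; 1F 2F → has≡true (one⇒inside {S} φ p″)
                           ; 2F 0F → has≡false ¬i′j
                           ; 2F 1F → has≡true (one⇒inside {S} φ p′)
                           ; 2F 2F → has≡true i′j″ }
      }

  open Windows S convex

  Matrix : Set
  Matrix = Vec (Row (width S)) (height S)

  toMatrix : Filling S → Matrix
  toMatrix φ = tabulate λ t → tabulate λ i → isOneCell {S} φ i (opposite t)

  fromMatrix : Matrix → Filling S
  fromMatrix M i j _ = cell M (opposite j) i

  toMatrix-cell : ∀ φ t i → cell (toMatrix φ) t i ≡ isOneCell {S} φ i (opposite t)
  toMatrix-cell φ t i = trans (cong (λ X → lookup X i) (lookup∘tabulate _ t)) (lookup∘tabulate _ i)

  cell⇒one : ∀ φ {t i} → cell (toMatrix φ) t i ≡ true → One {S} φ i (opposite t)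
  cell⇒one φ {t} {i} p = trans (sym (toMatrix-cell φ t i)) p

  one⇒cell : ∀ φ {i j} → One {S} φ i j → cell (toMatrix φ) (opposite j) i ≡ true
  one⇒cell φ {i} {j} p =
    trans (toMatrix-cell φ (opposite j) i) (trans (cong (isOneCell {S} φ i) (opposite-involutive j)) p)

  in⇒cell : ∀ {i j} → In i j → cell shapeRows (opposite j) i ≡ true
  in⇒cell {i} {j} c = has⇒cell (opposite j) i (subst (In i) (sym (opposite-involutive j)) c)

  one⇒masked : ∀ φ {t i} → cell (toMatrix φ) t i ≡ true → cell shapeRows t i ≡ true
  one⇒masked φ {t} {i} p = has⇒cell t i (one⇒inside {S} φ (cell⇒one φ p))

  acceptδ acceptι : Matrix → Bool
  acceptδ M = Limits.accept shapeRows (width S) M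
  acceptι M = Words.accept shapeRows (Vec.replicate (width S) ◇) M

  chain⇒accept : ∀ φ → Chain φ → acceptδ (toMatrix φ) ≡ true
  chain⇒accept φ ch = acceptLimit⇐ shapeRows (width S) (toMatrix φ) λ t i p →
    one⇒masked φ p , Finₚ.toℕ<n i , λ t′ lt i′ p′ →
    ch (cell⇒one φ p) (cell⇒one φ p′) (opposite-< lt)

  accept⇒chain : ∀ φ → acceptδ (toMatrix φ) ≡ true → Chain φ
  accept⇒chain φ e {i} {i′} {j} {j′} p p′ lt =
    proj₂ (proj₂ (acceptLimit⇒ shapeRows (width S) (toMatrix φ) e (opposite j) i (one⇒cell φ p)))
      (opposite j′) (opposite-< lt) i′ (one⇒cell φ p′)

  true≢false : ∀ {b} → b ≡ true → ¬ (b ≡ false)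
  true≢false refl ()

  accept⇒good : ∀ φ → acceptι (toMatrix φ) ≡ true → Good φ
  accept⇒good φ e {i} {j} p (i′ , j′ , i<i′ , j<j′ , ij′ , p′) (i″ , j″ , i<i″ , j<j″ , i″j , p″)
    with proj₂ (acceptWord⇒ shapeRows (Vec.replicate (width S) ◇) (toMatrix φ) e (opposite j) i (one⇒cell φ p))
  ... | inj₁ (_ , rg) = true≢false (one⇒cell φ p′) (rg (opposite j′) (opposite-< j<j′) (in⇒cell ij′) i′ i<i′)
  ... | inj₂ (_ , cg) = true≢false (one⇒cell φ p″) (cg i″ i<i″ (in⇒cell i″j) (opposite j″) (opposite-< j<j″))

  good⇒accept : ∀ φ → Good φ → acceptι (toMatrix φ) ≡ true
  good⇒accept φ g = acceptWord⇐ shapeRows (Vec.replicate (width S) ◇) (toMatrix φ) λ t i p →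
    one⇒masked φ p , side t i p
    where
    M = toMatrix φ
    blank : ∀ i → lookup (Vec.replicate (width S) ◇) i ≡ ◇
    blank i = lookup-replicate i ◇
    side : ∀ t i → cell M t i ≡ true → _
    side t i p with any? (λ t′ → any? λ i′ → (t′ Finₚ.<? t) ×-dec (i Finₚ.<? i′) ×-dec
                    (cell shapeRows t′ i Boolₚ.≟ true) ×-dec (cell M t′ i′ Boolₚ.≟ true))
    ... | no ¬rb = inj₁ (cong rowClear (blank i) , λ t′ lt b i′ lt′ →
                     ¬-not λ p′ → ¬rb (t′ , i′ , lt , lt′ , b , p′))
    ... | yes (t′ , i′ , lt , lt′ , b , p′) = inj₂ ((λ i″ _ _ → cong occupied (blank i″)) , λ i″ lt″ b″ t″ lt‴ →
      ¬-not λ p″ → g (cell⇒one φ p)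
        (i′ , opposite t′ , lt′ , opposite-< lt , cell⇒has t′ i b , cell⇒one φ p′)
        (i″ , opposite t″ , lt″ , opposite-< lt‴ , cell⇒has t i″ b″ , cell⇒one φ p″))

-- Enumerating the fillings

sumOver-filterᵇ : ∀ {A : Set} (p : A → Bool) xs f → sumOver (filterᵇ p xs) f ≡ sumOver xs (λ x → χ (p x) (f x))
sumOver-filterᵇ p []       f = refl
sumOver-filterᵇ p (x ∷ xs) f with p x
... | true  = cong (f x +_) (sumOver-filterᵇ p xs f)
... | false = sumOver-filterᵇ p xs f

vecs-unique : ∀ {A : Set} {xs : List A} → Unique xs → ∀ n → Unique (vecs xs n)
vecs-unique u zero    = [] ∷ []
vecs-unique u (suc n) = cartesianProductWith⁺ _∷_ ∷-injective u (vecs-unique u n)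

vecs-complete : ∀ {A : Set} {xs : List A} → (∀ x → x ∈ xs) → ∀ {n} (v : Vec A n) → v ∈ vecs xs n
vecs-complete c []      = here refl
vecs-complete c (x ∷ v) = ∈-cartesianProductWith⁺ _∷_ (c x) (vecs-complete c v)

unique-lookup : ∀ {A : Set} {xs : List A} → Unique xs → ∀ i j → List.lookup xs i ≡ List.lookup xs j → i ≡ j
unique-lookup (x≢ ∷ u) zero    zero    e = refl
unique-lookup (x≢ ∷ u) zero    (suc j) e = contradiction e (All.lookup x≢ (∈-lookup j))
unique-lookup (x≢ ∷ u) (suc i) zero    e = contradiction (sym e) (All.lookup x≢ (∈-lookup i))
unique-lookup (x≢ ∷ u) (suc i) (suc j) e = cong suc (unique-lookup u i j e)

module _ {A K : Set} (key : A → K) (_≟ᴷ_ : DecidableEquality K) where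

  open Permutation (On.setoid (≡.setoid K) key) using (_↭_; ↭-refl; ↭-sym; ↭-trans; prep)
  open Permutationₚ (On.setoid (≡.setoid K) key) using (shift)

  occurrences : List A → K → ℕ
  occurrences xs k = sumOver xs λ x → χ (does (key x ≟ᴷ k)) 1

  occurrences-shift : ∀ xs y ys k → occurrences (xs ++ y ∷ ys) k ≡ occurrences (y ∷ xs ++ ys) k
  occurrences-shift xs y ys k = trans (sumOver-++ xs (y ∷ ys) _)
    (trans (swap-first (occurrences xs k) (χ (does (key y ≟ᴷ k)) 1) (occurrences ys k)) (cong (χ (does (key y ≟ᴷ k)) 1 +_) (sym (sumOver-++ xs ys _))))

  occurs : ∀ xs k → ¬ (occurrences xs k ≡ 0) → ∃ λ x → x ∈ xs × key x ≡ k
  occurs []       k n = contradiction refl n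
  occurs (x ∷ xs) k n with key x ≟ᴷ k
  ... | yes e = x , here refl , e
  ... | no  _ = let y , y∈ , e = occurs xs k n in y , there y∈ , e

  occurrences-here : ∀ x xs → occurrences (x ∷ xs) (key x) ≡ suc (occurrences xs (key x))
  occurrences-here x xs rewrite dec-true (key x ≟ᴷ key x) refl = refl

  -- The head of `xs` has a partner with the same key in `ys`, and removing both keeps all counts
  -- equal.
  occurrences⇒↭ : ∀ xs ys → (∀ k → occurrences xs k ≡ occurrences ys k) → xs ↭ ys
  occurrences⇒↭ []       []       e = ↭-refl
  occurrences⇒↭ []       (y ∷ ys) e with () ← trans (e (key y)) (occurrences-here y ys)
  occurrences⇒↭ (x ∷ xs) ys       e
    with occurs ys (key x) (λ z → 0≢suc (trans (sym z) (trans (sym (e (key x))) (occurrences-here x xs))))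
    where
    0≢suc : ∀ {n} → ¬ (0 ≡ suc n)
    0≢suc ()
  ... | y , y∈ys , ky≡kx with ∈-∃++ y∈ys
  ... | as , bs , refl = ↭-trans (prep refl (occurrences⇒↭ xs (as ++ bs) rest)) (↭-sym (shift ky≡kx as bs))
    where
    rest : ∀ k → occurrences xs k ≡ occurrences (as ++ bs) k
    rest k = +-cancelˡ-≡ (χ (does (key x ≟ᴷ k)) 1) _ _ (trans (e k) (trans (occurrences-shift as y bs k)
      (cong (λ k′ → χ (does (k′ ≟ᴷ k)) 1 + occurrences (as ++ bs) k) ky≡kx)))

-- The bijection for a skew shape

module _ (S : Shape) (skew : IsSkew S) where

  open Avoidance S (skew⇒convex skew)
  open Windows S (skew⇒convex skew)

  matrices : List Matrix
  matrices = vecs (rows (width S)) (height S)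

  matrices-unique : Unique matrices
  matrices-unique = vecs-unique (vecs-unique (((λ ()) ∷ []) ∷ [] ∷ []) (width S)) (height S)

  matrices-complete : ∀ M → M ∈ matrices
  matrices-complete = vecs-complete (vecs-complete λ { false → here refl ; true → there (here refl) })

  toMatrix-cong : ∀ {φ ψ : Filling S} → (∀ i j .(c : T (has S i j)) → φ i j c ≡ ψ i j c) → toMatrix φ ≡ toMatrix ψ
  toMatrix-cong {φ} {ψ} e = tabulate-cong λ t → tabulate-cong λ i → same i (opposite t)
    where
    same : ∀ i j → isOneCell {S} φ i j ≡ isOneCell {S} ψ i j
    same i j with T? (has S i j)
    ... | yes c = e i j c
    ... | no  _ = refl

  fromMatrix-toMatrix : ∀ φ i j .(c : T (has S i j)) → fromMatrix (toMatrix φ) i j c ≡ φ i j c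
  fromMatrix-toMatrix φ i j c = trans (toMatrix-cell φ (opposite j) i)
    (trans (cong (isOneCell {S} φ i) (opposite-involutive j)) (isOneCell-inside {S} φ c))

  Masked : Matrix → Set
  Masked M = ∀ t i → cell M t i ≡ true → cell shapeRows t i ≡ true

  -- A filling reads as 0 outside `S`, so a matrix survives the round trip when its ones lie inside
  -- the shape.
  toMatrix-fromMatrix : ∀ M → Masked M → toMatrix (fromMatrix M) ≡ M
  toMatrix-fromMatrix M masked = trans
    (tabulate-cong λ t → trans (tabulate-cong (same t)) (tabulate∘lookup (lookup M t))) (tabulate∘lookup M)
    where
    same : ∀ t i → isOneCell {S} (fromMatrix M) i (opposite t) ≡ cell M t i
    same t i with T? (has S i (opposite t))
    ... | yes _ = cong (λ t′ → cell M t′ i) (opposite-involutive t)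
    ... | no ¬c with cell M t i in eq
    ...   | false = refl
    ...   | true  = contradiction (cell⇒has t i (masked t i eq)) ¬c

  rowOnes-rowSums : ∀ φ j → rowOnes {S} φ j ≡ lookup (rowSums (toMatrix φ)) (opposite j)
  rowOnes-rowSums φ j = sym (trans (lookup-map (opposite j) ∣_∣ (toMatrix φ))
    (trans (cong ∣_∣ (lookup∘tabulate _ (opposite j)))
           (cong (λ j′ → ∣ tabulate (λ i → isOneCell {S} φ i j′) ∣) (opposite-involutive j))))

  -- Lists the fillings satisfying `A` through their matrices. The list of accepted matrices has no
  -- repetitions, so equal fillings get equal positions.
  module Enumeration (A : Pred (Filling S) 0ℓ) (accept : Matrix → Bool)
                     (accept⇐ : ∀ φ → A φ → accept (toMatrix φ) ≡ true)
                     (accept⇒ : ∀ φ → accept (toMatrix φ) ≡ true → A φ)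
                     (accept-masked : ∀ M → accept M ≡ true → Masked M) where

    accepted : List Matrix
    accepted = filterᵇ accept matrices

    accepted-unique : Unique accepted
    accepted-unique = filter⁺ (T? ∘ accept) matrices-unique

    ∈-accepted : ∀ φ → A φ → toMatrix φ ∈ accepted
    ∈-accepted φ a = ∈-filter⁺ (T? ∘ accept) (matrices-complete (toMatrix φ)) (Equivalence.from T-≡ (accept⇐ φ a))

    position : Σ (Filling S) A → Fin (length accepted)
    position (φ , a) = index (∈-accepted φ a)

    lookup-position : ∀ x → List.lookup accepted (position x) ≡ toMatrix (proj₁ x)
    lookup-position (φ , a) = sym (lookup-index (∈-accepted φ a))

    filling : Fin (length accepted) → Filling S
    filling i = fromMatrix (List.lookup accepted i)

    lookup-accepted : ∀ i → accept (List.lookup accepted i) ≡ true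
    lookup-accepted i = Equivalence.to T-≡ (proj₂ (∈-filter⁻ (T? ∘ accept) {xs = matrices} (∈-lookup i)))

    toMatrix-filling : ∀ i → toMatrix (filling i) ≡ List.lookup accepted i
    toMatrix-filling i = toMatrix-fromMatrix _ (accept-masked _ (lookup-accepted i))

    enumeration : Inverse (≡.setoid (Fin (length accepted))) (fillingsWith S A)
    enumeration = record
      { to        = λ i → filling i , accept⇒ (filling i) (trans (cong accept (toMatrix-filling i)) (lookup-accepted i))
      ; from      = position
      ; to-cong   = λ { refl i j c → refl }
      ; from-cong = λ {x} {y} e → unique-lookup accepted-unique (position x) (position y)
                      (trans (lookup-position x) (trans (toMatrix-cong e) (sym (lookup-position y))))
      ; inverse   = (λ { {x} refl i j c → trans (cong (λ M → cell M (opposite j) i) (lookup-position x))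
                                                (fromMatrix-toMatrix (proj₁ x) i j c) })
                  , λ {i} {y} e → unique-lookup accepted-unique (position y) i
                      (trans (lookup-position y) (trans (toMatrix-cong e) (toMatrix-filling i)))
      }

  module δ = Enumeration (λ φ → Avoids {S} {□₂} φ δ₂) acceptδ
    (λ φ → chain⇒accept φ ∘ avoidsδ⇒chain φ) (λ φ → chain⇒avoidsδ φ ∘ accept⇒chain φ)
    (λ M e t i p → proj₁ (acceptLimit⇒ shapeRows (width S) M e t i p))

  module ι = Enumeration (λ φ → Avoids {S} {□₂} φ ι₂ × Avoids {S} {D} φ φD) acceptι
    (λ φ (a , b) → good⇒accept φ (avoids⇒good φ a b)) (λ φ → good⇒avoids φ ∘ accept⇒good φ)
    (λ M e t i p → proj₁ (acceptWord⇒ shapeRows _ M e t i p))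

  bySums = On.setoid (≡.setoid (Vec ℕ (height S))) (rowSums {width S})
  open Permutation bySums using (_↭_; onIndices)
  open Permutationₚ bySums using (onIndices-lookup)

  -- Each vector of row sums occurs equally often in both lists, by `completions-agree`, so they can
  -- be matched with row sums preserved.
  accepted-↭ : δ.accepted ↭ ι.accepted
  accepted-↭ = occurrences⇒↭ rowSums _≟ᵛ_ δ.accepted ι.accepted λ v →
    trans (sumOver-filterᵇ acceptδ matrices _)
    (trans (Limits.completions-count shapeRows (width S) v)
    (trans (completions-agree windows-descending v)
    (trans (sym (Words.completions-count shapeRows _ v))
           (sym (sumOver-filterᵇ acceptι matrices _)))))

  -- The second class is indexed through the permutation, so that equal indices in the two
  -- enumerations have equal row sums.
  ι-enumeration : Inverse (≡.setoid (Fin (length δ.accepted))) (Avoidι₂φD S)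
  ι-enumeration = Composition.inverse (onIndices accepted-↭) ι.enumeration

  bijection : Bijection (Avoidδ₂ S) (Avoidι₂φD S)
  bijection = Inverse⇒Bijection (Composition.inverse (Symmetry.inverse δ.enumeration) ι-enumeration)

  bijection-rowOnes : PreservesRowOnes S bijection
  bijection-rowOnes x j = trans (rowOnes-rowSums (proj₁ (Bijection.to bijection x)) j)
    (trans (cong (λ v → lookup v (opposite j)) same) (sym (rowOnes-rowSums (proj₁ x) j)))
    where
    i = δ.position x
    same : rowSums (toMatrix (proj₁ (Bijection.to bijection x))) ≡ rowSums (toMatrix (proj₁ x))
    same = trans (cong rowSums (ι.toMatrix-filling (Inverse.to (onIndices accepted-↭) i)))
      (trans (sym (onIndices-lookup accepted-↭ i)) (cong rowSums (δ.lookup-position x)))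

theorem2p6 : (S : Shape) → IsSkew S →
    (∃ λ n → HasSize (Avoidδ₂ S) n × HasSize (Avoidι₂φD S) n)
    × Σ (Bijection (Avoidδ₂ S) (Avoidι₂φD S)) (PreservesRowOnes S)
theorem2p6 S skew =
  (length (δ.accepted S skew) , δ.enumeration S skew , ι-enumeration S skew) ,
  (bijection S skew , bijection-rowOnes S skew)
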